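{- For $n\ge 2$ let $K_n^*$ be the index of a peak (a maximal term) of the sequence $D(n,1),D(n,2),\dots,D(n,n)$. Then, as $n\to\infty$, $$K_n^*\sim\frac{n}{\log n},$$ that is, $\lim_{n\to\infty}K_n^*\,\frac{\log n}{n}=1$.
   Context: For positive integers $n,k$, $D(n,k)$ denotes the number of partitions of $[n]=\{1,\dots,n\}$ into exactly $k$ blocks, each block consisting of more than one element. $\log$ is the natural logarithm. -}

module Defs where

open import Data.Fin.Subset using (Subset; inside; outside; ⊤; ⋃; _∩_; Empty; ∣_∣)
open import Data.Fin.Subset.Properties using (nonempty?)
open import Data.Bool.Properties using () renaming (_≟_ to _≟ᵇ_)
open import Data.Integer.Base as ℤ using (+_)
import Data.Integer.Properties as ℤ
open import Data.List.Base using (List; []; _∷_; _++_; map; length; filter)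
open import Data.List.Relation.Unary.All using (All; all?)
open import Data.List.Relation.Unary.AllPairs using (AllPairs; allPairs?)
open import Data.Nat.Base as ℕ using (ℕ; zero; suc; pred; NonZero)
import Data.Nat.Properties as ℕ
open import Data.Product.Base using (∃-syntax; _×_; _,_)
open import Data.Rational.Base as ℚ using (ℚ; 0ℚ; 1ℚ; ½; _/_; mkℚ)
import Data.Rational.Properties as ℚ
open import Data.Rational.Solver using (module +-*-Solver)
import Data.Rational.Unnormalised.Base as ℚᵘ
import Data.Rational.Unnormalised.Properties as ℚᵘ
open import Data.Sum.Base using (inj₁; inj₂)
open import Data.Vec.Base using ([]; _∷_)
open import Data.Vec.Properties using (≡-dec)
open import Relation.Binary.PropositionalEquality using (_≡_; refl; sym; trans; cong; cong₂; subst; subst₂)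
open import Relation.Nullary.Decidable using (Dec; ¬?; _×-dec_; map′)

Disjoint : ∀ {n} → Subset n → Subset n → Set
Disjoint p q = Empty (p ∩ q)

record IsPartition {n : ℕ} (k : ℕ) (𝓑 : List (Subset n)) : Set where
  constructor mkIsPartition
  field
    blockCount : length 𝓑 ≡ k
    blockSizes : All (λ B → 1 ℕ.< ∣ B ∣) 𝓑
    disjoint   : AllPairs Disjoint 𝓑
    covers     : ⋃ 𝓑 ≡ ⊤

isPartition? : ∀ {n} k (𝓑 : List (Subset n)) → Dec (IsPartition k 𝓑)
isPartition? k 𝓑 = map′
  (λ (a , b , c , d) → mkIsPartition a b c d)
  (λ (mkIsPartition a b c d) → a , b , c , d)
  (length 𝓑 ℕ.≟ k ×-dec
   all? (λ B → 1 ℕ.<? ∣ B ∣) 𝓑 ×-dec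
   allPairs? (λ p q → ¬? (nonempty? (p ∩ q))) 𝓑 ×-dec
   ≡-dec _≟ᵇ_ (⋃ 𝓑) ⊤)

subsets : ∀ n → List (Subset n)
subsets zero    = [] ∷ []
subsets (suc n) = map (outside ∷_) (subsets n) ++ map (inside ∷_) (subsets n)

sublists : ∀ {A : Set} → List A → List (List A)
sublists []       = [] ∷ []
sublists (x ∷ xs) = sublists xs ++ map (x ∷_) (sublists xs)

-- subsets n lists every subset exactly once, so its sublists represent every
-- set of subsets exactly once, and a partition is such a set of blocks.
D : ℕ → ℕ → ℕ
D n k = length (filter (isPartition? k) (sublists (subsets n)))

record IsPeak (n k : ℕ) : Set where
  field
    1≤k     : 1 ℕ.≤ k
    k≤n     : k ℕ.≤ n
    maximal : ∀ j → 1 ℕ.≤ j → j ℕ.≤ n → D n j ℕ.≤ D n k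


record ℝ : Set where
  constructor mkℝ
  field
    seq    : ℕ → ℚ
    cauchy : ∀ ε → 0ℚ ℚ.< ε →
             ∃[ N ] (∀ m n → N ℕ.≤ m → N ℕ.≤ n → ℚ.∣ seq m ℚ.- seq n ∣ ℚ.< ε)

open ℝ public

infix 4 _<_

_<_ : ℝ → ℝ → Set
x < y = ∃[ δ ] (0ℚ ℚ.< δ × ∃[ N ] (∀ m → N ℕ.≤ m → seq x m ℚ.+ δ ℚ.≤ seq y m))

fromℚ : ℚ → ℝ
fromℚ q .seq    _ = q
fromℚ q .cauchy ε 0<ε = 0 , λ _ _ _ _ →
  subst (λ d → ℚ.∣ d ∣ ℚ.< ε) (sym (ℚ.+-inverseʳ q)) 0<ε

private
  0<½ε : ∀ {ε} → 0ℚ ℚ.< ε → 0ℚ ℚ.< ½ ℚ.* ε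
  0<½ε {ε} 0<ε = subst (ℚ._< ½ ℚ.* ε) (ℚ.*-zeroʳ ½) (ℚ.*-monoʳ-<-pos ½ 0<ε)

  ½ε+½ε : ∀ ε → ½ ℚ.* ε ℚ.+ ½ ℚ.* ε ≡ ε
  ½ε+½ε ε = trans (sym (ℚ.*-distribʳ-+ ε ½ ½)) (ℚ.*-identityˡ ε)

  minus-swap : ∀ a b c d → (a ℚ.- b) ℚ.- (c ℚ.- d) ≡ (a ℚ.- c) ℚ.- (b ℚ.- d)
  minus-swap = solve 4 (λ a b c d → (a :- b) :- (c :- d) := (a :- c) :- (b :- d)) refl
    where open +-*-Solver

  a-b+b≡a : ∀ a b → (a ℚ.- b) ℚ.+ b ≡ a
  a-b+b≡a = solve 2 (λ a b → (a :- b) :+ b := a) refl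
    where open +-*-Solver

  a+b-b≡a : ∀ a b → (a ℚ.+ b) ℚ.- b ≡ a
  a+b-b≡a = solve 2 (λ a b → (a :+ b) :- b := a) refl
    where open +-*-Solver

  neg-minus : ∀ a b → ℚ.- (a ℚ.- b) ≡ b ℚ.- a
  neg-minus = solve 2 (λ a b → :- (a :- b) := b :- a) refl
    where open +-*-Solver

  minus-≤ : ∀ {a b c} → a ℚ.≤ c ℚ.+ b → a ℚ.- b ℚ.≤ c
  minus-≤ {a} {b} {c} h = subst (a ℚ.- b ℚ.≤_) (a+b-b≡a c b) (ℚ.+-monoˡ-≤ (ℚ.- b) h)

  abs-≤ : ∀ a b {c} → a ℚ.≤ c ℚ.+ b → b ℚ.≤ c ℚ.+ a → ℚ.∣ a ℚ.- b ∣ ℚ.≤ c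
  abs-≤ a b {c} h₁ h₂ with ℚ.∣p∣≡p∨∣p∣≡-p (a ℚ.- b)
  ... | inj₁ eq = subst (ℚ._≤ c) (sym eq) (minus-≤ h₁)
  ... | inj₂ eq = subst (ℚ._≤ c) (sym (trans eq (neg-minus a b))) (minus-≤ h₂)

  abs-sym : ∀ a b → ℚ.∣ a ℚ.- b ∣ ≡ ℚ.∣ b ℚ.- a ∣
  abs-sym a b = trans (sym (ℚ.∣-p∣≡∣p∣ (a ℚ.- b))) (cong ℚ.∣_∣ (neg-minus a b))

  ∣a∣≤∣a-b∣+∣b∣ : ∀ a b → ℚ.∣ a ∣ ℚ.≤ ℚ.∣ a ℚ.- b ∣ ℚ.+ ℚ.∣ b ∣
  ∣a∣≤∣a-b∣+∣b∣ a b = subst (λ t → ℚ.∣ t ∣ ℚ.≤ ℚ.∣ a ℚ.- b ∣ ℚ.+ ℚ.∣ b ∣) (a-b+b≡a a b)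
    (ℚ.∣p+q∣≤∣p∣+∣q∣ (a ℚ.- b) b)

  ∣∣a∣-∣b∣∣≤∣a-b∣ : ∀ a b → ℚ.∣ ℚ.∣ a ∣ ℚ.- ℚ.∣ b ∣ ∣ ℚ.≤ ℚ.∣ a ℚ.- b ∣
  ∣∣a∣-∣b∣∣≤∣a-b∣ a b = abs-≤ ℚ.∣ a ∣ ℚ.∣ b ∣ (∣a∣≤∣a-b∣+∣b∣ a b)
    (subst (λ t → ℚ.∣ b ∣ ℚ.≤ t ℚ.+ ℚ.∣ a ∣) (abs-sym b a) (∣a∣≤∣a-b∣+∣b∣ b a))

infixl 6 _-_
infixl 7 _·_

_-_ : ℝ → ℝ → ℝ
(x - y) .seq    m = seq x m ℚ.- seq y m
(x - y) .cauchy ε 0<ε =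
  let N₁ , h₁ = cauchy x (½ ℚ.* ε) (0<½ε 0<ε)
      N₂ , h₂ = cauchy y (½ ℚ.* ε) (0<½ε 0<ε)
  in N₁ ℕ.⊔ N₂ , λ m n N≤m N≤n → begin-strict
    ℚ.∣ (seq x m ℚ.- seq y m) ℚ.- (seq x n ℚ.- seq y n) ∣
      ≡⟨ cong ℚ.∣_∣ (minus-swap (seq x m) (seq y m) (seq x n) (seq y n)) ⟩
    ℚ.∣ (seq x m ℚ.- seq x n) ℚ.- (seq y m ℚ.- seq y n) ∣
      ≤⟨ ℚ.∣p-q∣≤∣p∣+∣q∣ (seq x m ℚ.- seq x n) (seq y m ℚ.- seq y n) ⟩
    ℚ.∣ seq x m ℚ.- seq x n ∣ ℚ.+ ℚ.∣ seq y m ℚ.- seq y n ∣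
      <⟨ ℚ.+-mono-<
           (h₁ m n (ℕ.m⊔n≤o⇒m≤o N₁ N₂ N≤m) (ℕ.m⊔n≤o⇒m≤o N₁ N₂ N≤n))
           (h₂ m n (ℕ.m⊔n≤o⇒n≤o N₁ N₂ N≤m) (ℕ.m⊔n≤o⇒n≤o N₁ N₂ N≤n)) ⟩
    ½ ℚ.* ε ℚ.+ ½ ℚ.* ε
      ≡⟨ ½ε+½ε ε ⟩
    ε ∎
  where open ℚ.≤-Reasoning

abs : ℝ → ℝ
abs x .seq    m = ℚ.∣ seq x m ∣
abs x .cauchy ε 0<ε =
  let N , h = cauchy x ε 0<ε
  in N , λ m n N≤m N≤n →
    ℚ.≤-<-trans (∣∣a∣-∣b∣∣≤∣a-b∣ (seq x m) (seq x n)) (h m n N≤m N≤n)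

_·_ : ℚ → ℝ → ℝ
(q · x) .seq    m = q ℚ.* seq x m
(q · x) .cauchy ε 0<ε =
  let N , h = cauchy x δ 0<δ
  in N , λ m n N≤m N≤n → begin-strict
    ℚ.∣ q ℚ.* seq x m ℚ.- q ℚ.* seq x n ∣
      ≡⟨ cong ℚ.∣_∣ (factor q (seq x m) (seq x n)) ⟩
    ℚ.∣ q ℚ.* (seq x m ℚ.- seq x n) ∣
      ≡⟨ ℚ.∣p*q∣≡∣p∣*∣q∣ q (seq x m ℚ.- seq x n) ⟩
    ℚ.∣ q ∣ ℚ.* ℚ.∣ seq x m ℚ.- seq x n ∣
      ≤⟨ ℚ.*-monoʳ-≤-nonNeg ℚ.∣ seq x m ℚ.- seq x n ∣ {{ℚ.∣-∣-nonNeg (seq x m ℚ.- seq x n)}} ∣q∣≤c ⟩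
    c ℚ.* ℚ.∣ seq x m ℚ.- seq x n ∣
      <⟨ ℚ.*-monoʳ-<-pos c (h m n N≤m N≤n) ⟩
    c ℚ.* δ
      ≡⟨ cδ≡ε ⟩
    ε ∎
  where
  open ℚ.≤-Reasoning
  factor : ∀ q a b → q ℚ.* a ℚ.- q ℚ.* b ≡ q ℚ.* (a ℚ.- b)
  factor = solve 3 (λ q a b → q :* a :- q :* b := q :* (a :- b)) refl
    where open +-*-Solver
  c = ℚ.∣ q ∣ ℚ.+ 1ℚ
  ∣q∣≤c : ℚ.∣ q ∣ ℚ.≤ c
  ∣q∣≤c = subst (ℚ._≤ c) (ℚ.+-identityʳ ℚ.∣ q ∣)
    (ℚ.+-monoʳ-≤ ℚ.∣ q ∣ (ℚ.*≤* (ℤ.+≤+ ℕ.z≤n)))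
  instance
    c-pos : ℚ.Positive c
    c-pos = ℚ.nonNeg+pos⇒pos ℚ.∣ q ∣ {{ℚ.∣-∣-nonNeg q}} 1ℚ
    c-nz : ℚ.NonZero c
    c-nz = ℚ.pos⇒nonZero c
    1/c-pos : ℚ.Positive (ℚ.1/ c)
    1/c-pos = ℚ.1/pos⇒pos c
  δ = ℚ.1/ c ℚ.* ε
  0<δ : 0ℚ ℚ.< δ
  0<δ = subst (ℚ._< δ) (ℚ.*-zeroʳ (ℚ.1/ c)) (ℚ.*-monoʳ-<-pos (ℚ.1/ c) 0<ε)
  cδ≡ε : c ℚ.* δ ≡ ε
  cδ≡ε = trans (sym (ℚ.*-assoc c (ℚ.1/ c) ε))
        (trans (cong (ℚ._* ε) (ℚ.*-inverseʳ c)) (ℚ.*-identityˡ ε))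

infix 4 _⟶_

_⟶_ : ((n : ℕ) → .{{NonZero n}} → ℝ) → ℝ → Set
a ⟶ L = ∀ ε → 0ℚ ℚ.< ε →
  ∃[ N ] (∀ n → .{{_ : NonZero n}} → N ℕ.≤ n → abs (a n - L) < fromℚ ε)

-- 1/(a+1) + 1/(a+2) + … + 1/(a+l)
recipSum : ℕ → ℕ → ℚ
recipSum a zero    = 0ℚ
recipSum a (suc l) = recipSum a l ℚ.+ + 1 / suc (a ℕ.+ l)

-- The lower Riemann sum of ∫₁ⁿ dt/t with mesh 1/M, where M = m + 1, is
-- Σ (1/M) · 1/(1 + i/M) = Σ 1/(M + i), taken over 1 ≤ i ≤ (n - 1)M.
logSeq : ℕ → ℕ → ℚ
logSeq n m = recipSum (suc m) (pred n ℕ.* suc m)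

private
  /-≤ : ∀ a b c d → a ℕ.* suc d ℕ.≤ c ℕ.* suc b → + a / suc b ℚ.≤ + c / suc d
  /-≤ a b c d h = ℚ.toℚᵘ-cancel-≤ (begin
    ℚ.toℚᵘ (+ a / suc b)  ≃⟨ ℚ.toℚᵘ-fromℚᵘ (ℚᵘ.mkℚᵘ (+ a) b) ⟩
    ℚᵘ.mkℚᵘ (+ a) b       ≤⟨ ℚᵘ.*≤* (subst₂ ℤ._≤_ (ℤ.pos-* a (suc d)) (ℤ.pos-* c (suc b)) (ℤ.+≤+ h)) ⟩
    ℚᵘ.mkℚᵘ (+ c) d       ≃⟨ ℚ.toℚᵘ-fromℚᵘ (ℚᵘ.mkℚᵘ (+ c) d) ⟨
    ℚ.toℚᵘ (+ c / suc d)  ∎)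
    where open ℚᵘ.≤-Reasoning

  /-suc : ∀ r d → + suc r / suc d ≡ + r / suc d ℚ.+ + 1 / suc d
  /-suc r d = ℚ.toℚᵘ-injective (begin-equality
    ℚ.toℚᵘ (+ suc r / suc d)
      ≃⟨ ℚ.toℚᵘ-fromℚᵘ (ℚᵘ.mkℚᵘ (+ suc r) d) ⟩
    ℚᵘ.mkℚᵘ (+ suc r) d
      ≃⟨ ℚᵘ.*≡* eq ⟩
    ℚᵘ.mkℚᵘ (+ r) d ℚᵘ.+ ℚᵘ.mkℚᵘ (+ 1) d
      ≃⟨ ℚᵘ.+-cong (ℚ.toℚᵘ-fromℚᵘ (ℚᵘ.mkℚᵘ (+ r) d)) (ℚ.toℚᵘ-fromℚᵘ (ℚᵘ.mkℚᵘ (+ 1) d)) ⟨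
    ℚ.toℚᵘ (+ r / suc d) ℚᵘ.+ ℚ.toℚᵘ (+ 1 / suc d)
      ≃⟨ ℚ.toℚᵘ-homo-+ (+ r / suc d) (+ 1 / suc d) ⟨
    ℚ.toℚᵘ (+ r / suc d ℚ.+ + 1 / suc d) ∎)
    where
    open ℚᵘ.≤-Reasoning
    s = + suc d
    eq : + suc r ℤ.* (s ℤ.* s) ≡ (+ r ℤ.* s ℤ.+ + 1 ℤ.* s) ℤ.* s
    eq = trans (sym (ℤ.*-assoc (+ suc r) s s))
      (cong (ℤ._* s) (trans (cong (λ t → + t ℤ.* s) (sym (ℕ.+-comm r 1)))
                            (ℤ.*-distribʳ-+ s (+ r) (+ 1))))

  recipSum-≤ : ∀ a l → recipSum a l ℚ.≤ + l / suc a
  recipSum-≤ a zero    = /-≤ 0 0 0 a ℕ.z≤n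
  recipSum-≤ a (suc l) = subst (recipSum a (suc l) ℚ.≤_) (sym (/-suc l a))
    (ℚ.+-mono-≤ (recipSum-≤ a l)
      (/-≤ 1 (a ℕ.+ l) 1 a (ℕ.*-monoʳ-≤ 1 (ℕ.s≤s (ℕ.m≤m+n a l)))))

  recipSum-≥ : ∀ a l b → a ℕ.+ l ℕ.≤ suc b → + l / suc b ℚ.≤ recipSum a l
  recipSum-≥ a zero    b h = /-≤ 0 b 0 0 ℕ.z≤n
  recipSum-≥ a (suc l) b h = subst (ℚ._≤ recipSum a (suc l)) (sym (/-suc l b))
    (ℚ.+-mono-≤ (recipSum-≥ a l b (ℕ.≤-trans (ℕ.+-monoʳ-≤ a (ℕ.n≤1+n l)) h))
      (/-≤ 1 b 1 (a ℕ.+ l) (ℕ.*-monoʳ-≤ 1 (subst (ℕ._≤ suc b) (ℕ.+-suc a l) h))))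

  recipSum-head : ∀ a l → recipSum a (suc l) ≡ + 1 / suc a ℚ.+ recipSum (suc a) l
  recipSum-head a zero = trans (ℚ.+-comm 0ℚ (+ 1 / suc (a ℕ.+ 0)))
    (cong (λ t → + 1 / suc t ℚ.+ 0ℚ) (ℕ.+-identityʳ a))
  recipSum-head a (suc l) = trans
    (cong₂ ℚ._+_ (recipSum-head a l) (cong (λ t → + 1 / suc t) (ℕ.+-suc a l)))
    (ℚ.+-assoc (+ 1 / suc a) (recipSum (suc a) l) (+ 1 / suc (suc a ℕ.+ l)))

  recipSum-+ : ∀ a l r → recipSum a (l ℕ.+ r) ≡ recipSum a l ℚ.+ recipSum (a ℕ.+ l) r
  recipSum-+ a l zero = trans (cong (recipSum a) (ℕ.+-identityʳ l)) (sym (ℚ.+-identityʳ _))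
  recipSum-+ a l (suc r) = trans (cong (recipSum a) (ℕ.+-suc l r)) (trans
    (cong₂ ℚ._+_ (recipSum-+ a l r) (cong (λ t → + 1 / suc t) (sym (ℕ.+-assoc a l r))))
    (ℚ.+-assoc (recipSum a l) (recipSum (a ℕ.+ l) r) _))

  module _ (p : ℕ) where
    n = suc p

    u : ℕ → ℚ
    u = logSeq n

    block : ℕ → ℚ
    block m = recipSum (n ℕ.* suc m) n

    step : ∀ m → + 1 / suc (suc m) ℚ.+ u (suc m) ≡ u m ℚ.+ block m
    step m = trans (sym (recipSum-head (suc m) (p ℕ.* suc (suc m))))
      (trans (cong (recipSum (suc m)) eq) (recipSum-+ (suc m) (p ℕ.* suc m) n))
      where
      eq : suc (p ℕ.* suc (suc m)) ≡ p ℕ.* suc m ℕ.+ suc p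
      eq = trans (cong suc (trans (ℕ.*-suc p (suc m)) (ℕ.+-comm p _)))
                 (sym (ℕ.+-suc (p ℕ.* suc m) p))

    block-≥ : ∀ m → + 1 / suc (suc m) ℚ.≤ block m
    block-≥ m = ℚ.≤-trans
      (/-≤ 1 (suc m) n _ (ℕ.≤-reflexive (ℕ.*-identityˡ (n ℕ.* suc (suc m)))))
      (recipSum-≥ (n ℕ.* suc m) n _
        (ℕ.≤-reflexive (trans (ℕ.+-comm _ n) (sym (ℕ.*-suc n (suc m))))))

    block-≤ : ∀ m → block m ℚ.≤ + 1 / suc m
    block-≤ m = ℚ.≤-trans (recipSum-≤ (n ℕ.* suc m) n)
      (/-≤ n (n ℕ.* suc m) 1 m
        (ℕ.≤-trans (ℕ.n≤1+n _) (ℕ.≤-reflexive (sym (ℕ.*-identityˡ _)))))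

    u-step : ∀ m → u m ℚ.≤ u (suc m)
    u-step m = ℚ.≤-trans (ℚ.≤-reflexive (sym (trans (cong (ℚ._- r) (ℚ.+-comm r (u m))) (a+b-b≡a (u m) r))))
      (minus-≤ {r ℚ.+ u m} (begin
        r ℚ.+ u m        ≡⟨ ℚ.+-comm r (u m) ⟩
        u m ℚ.+ r        ≤⟨ ℚ.+-monoʳ-≤ (u m) (block-≥ m) ⟩
        u m ℚ.+ block m  ≡⟨ step m ⟨
        r ℚ.+ u (suc m)  ≡⟨ ℚ.+-comm r (u (suc m)) ⟩
        u (suc m) ℚ.+ r  ∎))
      where
      open ℚ.≤-Reasoning
      r = + 1 / suc (suc m)

    v-step : ∀ m → + 1 / suc (suc m) ℚ.+ u (suc m) ℚ.≤ + 1 / suc m ℚ.+ u m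
    v-step m = begin
      + 1 / suc (suc m) ℚ.+ u (suc m)  ≡⟨ step m ⟩
      u m ℚ.+ block m                  ≤⟨ ℚ.+-monoʳ-≤ (u m) (block-≤ m) ⟩
      u m ℚ.+ + 1 / suc m              ≡⟨ ℚ.+-comm (u m) _ ⟩
      + 1 / suc m ℚ.+ u m              ∎
      where open ℚ.≤-Reasoning

    u-mono : ∀ m k → u m ℚ.≤ u (k ℕ.+ m)
    u-mono m zero    = ℚ.≤-refl
    u-mono m (suc k) = ℚ.≤-trans (u-mono m k) (u-step (k ℕ.+ m))

    v-mono : ∀ m k → + 1 / suc (k ℕ.+ m) ℚ.+ u (k ℕ.+ m) ℚ.≤ + 1 / suc m ℚ.+ u m
    v-mono m zero    = ℚ.≤-refl
    v-mono m (suc k) = ℚ.≤-trans (v-step (k ℕ.+ m)) (v-mono m k)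

    0≤1/ : ∀ m → 0ℚ ℚ.≤ + 1 / suc m
    0≤1/ m = /-≤ 0 0 1 m ℕ.z≤n

    p≤q+p : ∀ a {b} → 0ℚ ℚ.≤ b → a ℚ.≤ b ℚ.+ a
    p≤q+p a {b} h = subst (ℚ._≤ b ℚ.+ a) (ℚ.+-identityˡ a) (ℚ.+-monoˡ-≤ a h)

    u-≤ : ∀ N m k → N ℕ.≤ m → N ℕ.≤ k → u m ℚ.≤ + 1 / suc N ℚ.+ u k
    u-≤ N m k N≤m N≤k = begin
      u m                      ≤⟨ p≤q+p (u m) (0≤1/ m) ⟩
      + 1 / suc m ℚ.+ u m      ≤⟨ subst (λ t → + 1 / suc t ℚ.+ u t ℚ.≤ + 1 / suc N ℚ.+ u N)
                                    (ℕ.m∸n+n≡m N≤m) (v-mono N (m ℕ.∸ N)) ⟩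
      + 1 / suc N ℚ.+ u N      ≤⟨ ℚ.+-monoʳ-≤ (+ 1 / suc N)
                                    (subst (λ t → u N ℚ.≤ u t) (ℕ.m∸n+n≡m N≤k) (u-mono N (k ℕ.∸ N))) ⟩
      + 1 / suc N ℚ.+ u k      ∎
      where open ℚ.≤-Reasoning

    u-close : ∀ N m k → N ℕ.≤ m → N ℕ.≤ k → ℚ.∣ u m ℚ.- u k ∣ ℚ.≤ + 1 / suc N
    u-close N m k N≤m N≤k =
      abs-≤ (u m) (u k) (u-≤ N m k N≤m N≤k) (u-≤ N k m N≤k N≤m)

  1/-small : ∀ ε → 0ℚ ℚ.< ε → ∃[ N ] + 1 / suc N ℚ.< ε
  1/-small ε@(mkℚ (+ zero) d _) 0<ε with ℚ.drop-*<* 0<ε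
  ... | ℤ.+<+ ()
  1/-small (mkℚ ℤ.-[1+ _ ] d _) 0<ε with ℚ.drop-*<* 0<ε
  ... | ()
  1/-small ε@(mkℚ (+ suc a) d _) _ = suc d , ℚ.toℚᵘ-cancel-< (begin-strict
    ℚ.toℚᵘ (+ 1 / suc (suc d))  ≃⟨ ℚ.toℚᵘ-fromℚᵘ (ℚᵘ.mkℚᵘ (+ 1) (suc d)) ⟩
    ℚᵘ.mkℚᵘ (+ 1) (suc d)       <⟨ ℚᵘ.*<* (subst₂ ℤ._<_ (ℤ.pos-* 1 (suc d)) (ℤ.pos-* (suc a) (suc (suc d))) (ℤ.+<+ lt)) ⟩
    ℚᵘ.mkℚᵘ (+ suc a) d         ∎)
    where
    open ℚᵘ.≤-Reasoning
    lt : 1 ℕ.* suc d ℕ.< suc a ℕ.* suc (suc d)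
    lt = ℕ.≤-trans (ℕ.s≤s (ℕ.≤-reflexive (ℕ.*-identityˡ (suc d))))
                   (ℕ.m≤m+n (suc (suc d)) (a ℕ.* suc (suc d)))

log : (n : ℕ) → .{{NonZero n}} → ℝ
log n .seq = logSeq n
log (suc p) .cauchy ε 0<ε =
  let N , 1/N<ε = 1/-small ε 0<ε
  in N , λ m k N≤m N≤k → ℚ.≤-<-trans (u-close p N m k N≤m N≤k) 1/N<ε

{-# OPTIONS --safe #-}
module Submission where

-- Write g(k) = kⁿ/k!.  Counting functions [n] → [k] whose fibres all have at least two elements gives
-- k! D(n,k) ≤ kⁿ, and a union bound over small fibres gives k! D(n,k) ≥ kⁿ/2 as long as n ≪ e^(n/k).
-- Up to constants this covers k₀ = n/Λ with Λ slightly larger than log n.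
-- The ratio g(k+1)/g(k) = (1 + 1/k)ⁿ/(k + 1) is at least 4 for k < k₀, so no peak lies below k₀.
-- With Λ = 4(p+2)ω, this ratio is at most 4^ω for k ≥ k₀ and at most 4^(-ω) for k ≥ k₂ = n/(4(p+1)ω),
-- so beyond 2k₂ - k₀ the gain made between k₀ and k₂ is lost again, and no peak lies there either.
-- Letting p → ∞ gives the limit.  Instead of e, the proof uses (1 + 1/T)ᵀ ≤ e ≤ (1 + 1/T)ᵀ⁺¹ for
-- T = 8(p+2), and log n is compared with powers of 1 + 1/T by cutting the Riemann sum into geometric blocks.

import Data.Bool.Base as Bool
open import Data.Bool.Base using (Bool; true; false; if_then_else_)
open import Data.Bool.Properties using () renaming (_≟_ to _≟ᵇ_)
open import Data.Empty using (⊥-elim)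
open import Data.Fin.Base using (zero; suc)
open import Data.Fin.Subset using (Subset; inside; outside; ⊤; ⊥; ⋃; _∪_; _∩_; ∣_∣)
open import Data.Fin.Subset.Properties using (x∈p∩q⁺; x∈p∩q⁻; x∈p∪q⁺; x∈p∪q⁻; ∉⊥; ∣⊥∣≡0; ∣⊤∣≡n; nonempty?)
import Data.Integer.Base as ℤ
import Data.Integer.Properties as ℤ
open import Data.List.Base using (List; []; _∷_; _++_; map; length; filter)
open import Data.List.Properties using (map-++; map-∘; map-cong; map-id; length-++; filter-++; filter-accept; filter-reject)
open import Data.List.Relation.Unary.All using (All; []; _∷_; all?)
open import Data.List.Relation.Unary.AllPairs using (AllPairs; []; _∷_; allPairs?)
open import Data.Maybe.Base using (Maybe; just; nothing; _>>=_) renaming (maybe′ to maybe)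
import Data.Maybe.Base as Maybe
open import Data.Maybe.Properties using (just-injective)
open import Data.Nat.Base hiding (_/_)
import Data.Nat.Base as ℕ
open import Data.Nat.DivMod using (m≡m%n+[m/n]*n; m%n<n; m/n*n≤m; /-mono-≤; /-monoʳ-≤; m*n/n≡m)
open import Data.Nat.ListAction using (sum)
open import Data.Nat.ListAction.Properties using (sum-++)
open import Data.Nat.Properties
open import Data.Nat.Solver using () renaming (module +-*-Solver to ℕ-Solver)
open import Data.Nat.Tactic.RingSolver using (solve-∀)
open import Data.Product.Base using (∃-syntax; _×_; _,_; proj₂)
open import Data.Rational.Base as ℚ using (ℚ; 0ℚ; 1ℚ; _/_; mkℚ)
import Data.Rational.Properties as ℚ
open import Data.Rational.Solver using (module +-*-Solver)
open import Data.Rational.Unnormalised.Base as ℚᵘ using (mkℚᵘ)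
import Data.Rational.Unnormalised.Properties as ℚᵘ
open import Data.Sum.Base using (inj₁; inj₂)
open import Data.Vec.Base using ([]; _∷_; here; there)
open import Data.Vec.Properties using (≡-dec)
open import Function.Base using (_∘_; id; case_of_)
open import Relation.Binary.PropositionalEquality
open import Relation.Nullary.Decidable using (yes; no; ¬?; _×-dec_)
open import Relation.Nullary.Negation using (¬_; contradiction)
open import Relation.Unary using (Decidable)
open import Defs hiding (_<_; _-_)

-- The factorial enters because ordering the blocks of a partition makes them the fibres of a
-- function to k points. Unlike `D`, the resulting count obeys a recursion in which only
-- cardinalities occur.
--
-- The constant 4 in Λ and in μ = 4(p+1)ω is a budget. Write β = (1 + 1/T)ᵀ and q = 4(p+2), so that
-- Λ = qω and T = 2q. The integer ω is chosen with 8n ≤ β^Λ ≤ 8nC, where C = 4^q bounds the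
-- overshoot caused by Λ being a multiple of q. Bounding the ratio g(k+1)/g(k) from above loses at
-- most 2^ω twice: 8CΛ ≤ 2^ω covers the overshoot and the denominator k + 1, and (1 + 1/2q)^(qω) ≤
-- 2^ω covers the gap between exponents T and T + 1. This is the 4^ω of the region k ≥ k₀. From k₂
-- on, Λ - μ = 4ω saves a factor 2^(4ω) = (4^ω)²: one half of the exponent cancels the loss, the
-- other makes the ratio at most 4^(-ω). The relative distance between Λ and μ is only 1/(p+2), so
-- k₀ and k₂ agree in the limit.
--
-- All inequalities between powers are cross-multiplied in ℕ; rationals appear only for the Riemann
-- sums.

-- Sums and counts over lists

∑ : ∀ {A : Set} → List A → (A → ℕ) → ℕ
∑ xs f = sum (map f xs)

∑-cong : ∀ {A : Set} (xs : List A) {f g : A → ℕ} → (∀ x → f x ≡ g x) → ∑ xs f ≡ ∑ xs g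
∑-cong xs eq = cong sum (map-cong eq xs)

∑-++ : ∀ {A : Set} (xs ys : List A) (f : A → ℕ) → ∑ (xs ++ ys) f ≡ ∑ xs f + ∑ ys f
∑-++ xs ys f = trans (cong sum (map-++ f xs ys)) (sum-++ (map f xs) (map f ys))

∑-map : ∀ {A B : Set} (xs : List A) (g : A → B) (f : B → ℕ) → ∑ (map g xs) f ≡ ∑ xs (f ∘ g)
∑-map xs g f = cong sum (sym (map-∘ xs))

∑-zero : ∀ {A : Set} (xs : List A) → ∑ xs (λ _ → 0) ≡ 0
∑-zero []       = refl
∑-zero (_ ∷ xs) = ∑-zero xs

∑-+-* : ∀ {A : Set} (xs : List A) (f g : A → ℕ) c →
        ∑ xs (λ x → f x + c * g x) ≡ ∑ xs f + c * ∑ xs g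
∑-+-* []       f g c = sym (*-zeroʳ c)
∑-+-* (x ∷ xs) f g c = trans (cong (f x + c * g x +_) (∑-+-* xs f g c))
  (solve 5 (λ a b c d e → a :+ c :* b :+ (d :+ c :* e) := a :+ d :+ c :* (b :+ e)) refl
    (f x) (g x) c (∑ xs f) (∑ xs g))
  where open ℕ-Solver

count : ∀ {A : Set} {P : A → Set} → Decidable P → List A → ℕ
count P? xs = length (filter P? xs)

count-++ : ∀ {A : Set} {P : A → Set} (P? : Decidable P) xs ys →
           count P? (xs ++ ys) ≡ count P? xs + count P? ys
count-++ P? xs ys = trans (cong length (filter-++ P? xs ys)) (length-++ (filter P? xs))

count-map : ∀ {A B : Set} {P : B → Set} {Q : A → Set} (P? : Decidable P) (Q? : Decidable Q)
            (f : A → B) → (∀ x → P (f x) → Q x) → (∀ x → Q x → P (f x)) →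
            ∀ xs → count P? (map f xs) ≡ count Q? xs
count-map P? Q? f to from [] = refl
count-map P? Q? f to from (x ∷ xs) with P? (f x) | Q? x
... | yes _ | yes _ = cong suc (count-map P? Q? f to from xs)
... | no  _ | no  _ = count-map P? Q? f to from xs
... | yes p | no ¬q = contradiction (to x p) ¬q
... | no ¬p | yes q = contradiction (from x q) ¬p

count-map-none : ∀ {A B : Set} {P : B → Set} (P? : Decidable P) (f : A → B) →
                 (∀ x → ¬ P (f x)) → ∀ xs → count P? (map f xs) ≡ 0
count-map-none P? f none [] = refl
count-map-none P? f none (x ∷ xs) with P? (f x)
... | yes p = contradiction p (none x)
... | no  _ = count-map-none P? f none xs

-- Families of blocks by successive removal

-- Failure means that x does not lie inside U, so a successful chain of removals is a chain of
-- pairwise disjoint subsets of U.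
remove : ∀ {n} → Subset n → Subset n → Maybe (Subset n)
remove []            []            = just []
remove (outside ∷ x) (b ∷ U)       = Maybe.map (b ∷_) (remove x U)
remove (inside ∷ x)  (outside ∷ U) = nothing
remove (inside ∷ x)  (inside ∷ U)  = Maybe.map (outside ∷_) (remove x U)

guarded : ∀ {A : Set} → Bool → Maybe A → Maybe A
guarded b m = if b then m else nothing

-- extract i x U is the complement of x in U, provided that x ⊆ U and i ≤ ∣ x ∣.
extract : ∀ {n} → ℕ → Subset n → Subset n → Maybe (Subset n)
extract i x U = guarded (i ≤ᵇ ∣ x ∣) (remove x U)

map->>= : ∀ {A B C E : Set} (m : Maybe A) {f : A → B} {g : B → Maybe C} {g′ : A → Maybe E} {f′ : E → C} →
          (∀ v → g (f v) ≡ Maybe.map f′ (g′ v)) →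
          (Maybe.map f m >>= g) ≡ Maybe.map f′ (m >>= g′)
map->>= nothing  eq = refl
map->>= (just v) eq = eq v

>>=-nothing : ∀ {A B : Set} (m : Maybe A) {g : A → Maybe B} → (∀ v → g v ≡ nothing) → (m >>= g) ≡ nothing
>>=-nothing nothing  eq = refl
>>=-nothing (just v) eq = eq v

map->>=-nothing : ∀ {A B C : Set} (m : Maybe A) {f : A → B} {g : B → Maybe C} →
                  (∀ v → g (f v) ≡ nothing) → (Maybe.map f m >>= g) ≡ nothing
map->>=-nothing nothing  eq = refl
map->>=-nothing (just v) eq = eq v

-- Both sides succeed exactly when x and y are disjoint subsets of U, and then leave the complement
-- of their union.
remove-comm : ∀ {n} (x y U : Subset n) → (remove x U >>= remove y) ≡ (remove y U >>= remove x)
remove-comm [] [] [] = refl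
remove-comm (outside ∷ x) (outside ∷ y) (b ∷ U) = trans
  (map->>= (remove x U) (λ _ → refl)) (trans
  (cong (Maybe.map (b ∷_)) (remove-comm x y U))
  (sym (map->>= (remove y U) (λ _ → refl))))
remove-comm (outside ∷ x) (inside ∷ y) (outside ∷ U) = map->>=-nothing (remove x U) (λ _ → refl)
remove-comm (outside ∷ x) (inside ∷ y) (inside ∷ U) = trans
  (map->>= (remove x U) (λ _ → refl)) (trans
  (cong (Maybe.map (outside ∷_)) (remove-comm x y U))
  (sym (map->>= (remove y U) (λ _ → refl))))
remove-comm (inside ∷ x) (outside ∷ y) (outside ∷ U) = sym (map->>=-nothing (remove y U) (λ _ → refl))
remove-comm (inside ∷ x) (outside ∷ y) (inside ∷ U) = trans
  (map->>= (remove x U) (λ _ → refl)) (trans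
  (cong (Maybe.map (outside ∷_)) (remove-comm x y U))
  (sym (map->>= (remove y U) (λ _ → refl))))
remove-comm (inside ∷ x) (inside ∷ y) (outside ∷ U) = refl
remove-comm (inside ∷ x) (inside ∷ y) (inside ∷ U) = trans
  (map->>=-nothing (remove x U) (λ _ → refl))
  (sym (map->>=-nothing (remove y U) (λ _ → refl)))

extract-comm : ∀ {n} i (x y U : Subset n) →
               (extract i x U >>= extract i y) ≡ (extract i y U >>= extract i x)
extract-comm i x y U with i ≤ᵇ ∣ x ∣ | i ≤ᵇ ∣ y ∣
... | true  | true  = remove-comm x y U
... | true  | false = >>=-nothing (remove x U) (λ _ → refl)
... | false | true  = sym (>>=-nothing (remove y U) (λ _ → refl))
... | false | false = refl

-- A point of x is gone after the first removal. Hence no tuple of blocks contains a block twice.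
remove-twice : ∀ {n} (x U : Subset n) → 0 < ∣ x ∣ → (remove x U >>= remove x) ≡ nothing
remove-twice (outside ∷ x) (b ∷ U) 0<x = trans
  (map->>= (remove x U) (λ _ → refl)) (cong (Maybe.map (b ∷_)) (remove-twice x U 0<x))
remove-twice (inside ∷ x) (outside ∷ U) 0<x = refl
remove-twice (inside ∷ x) (inside ∷ U) 0<x = map->>=-nothing (remove x U) (λ _ → refl)

extract-just : ∀ {n} i (x U : Subset n) {V} → extract i x U ≡ just V → i ≤ ∣ x ∣ × remove x U ≡ just V
extract-just i x U eq with i ≤ᵇ ∣ x ∣ in b
... | true = ≤ᵇ⇒≤ i ∣ x ∣ (subst Bool.T (sym b) _) , eq

extract-≤ : ∀ {n} i (x U : Subset n) → i ≤ ∣ x ∣ → extract i x U ≡ remove x U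
extract-≤ i x U i≤x with i ≤ᵇ ∣ x ∣ | ≤⇒≤ᵇ i≤x
... | true | _ = refl

extract-twice : ∀ {n} i (x U : Subset n) {V} → extract (suc i) x U ≡ just V → extract (suc i) x V ≡ nothing
extract-twice i x U {V} eq with extract-just (suc i) x U eq
... | i<x , eq′ = trans (extract-≤ (suc i) x V i<x)
  (trans (cong (_>>= remove x) (sym eq′)) (remove-twice x U (≤-trans (s≤s z≤n) i<x)))

-- The number of sets of k blocks in xs, resp. of k-tuples of blocks in xs, that partition U.

unordered : ∀ {n} → List (Subset n) → ℕ → Subset n → ℕ
unordered []       zero    U = 0 ^ ∣ U ∣
unordered []       (suc k) U = 0
unordered (x ∷ xs) zero    U = unordered xs zero U
unordered (x ∷ xs) (suc k) U = unordered xs (suc k) U + maybe (unordered xs k) 0 (extract 2 x U)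

ordered : ∀ {n} → List (Subset n) → ℕ → Subset n → ℕ
ordered xs zero    U = 0 ^ ∣ U ∣
ordered xs (suc k) U = ∑ xs (λ x → maybe (ordered xs k) 0 (extract 2 x U))

maybe->>= : ∀ {A B : Set} (m : Maybe A) (g : A → Maybe B) (h : B → ℕ) →
            maybe (λ v → maybe h 0 (g v)) 0 m ≡ maybe h 0 (m >>= g)
maybe->>= nothing  g h = refl
maybe->>= (just _) g h = refl

∑-maybe : ∀ {A B : Set} (xs : List A) (m : Maybe B) (g : A → B → ℕ) →
          ∑ xs (λ x → maybe (g x) 0 m) ≡ maybe (λ v → ∑ xs (λ x → g x v)) 0 m
∑-maybe xs nothing  g = ∑-zero xs
∑-maybe xs (just v) g = refl

-- A tuple containing the new block x contains it once, in one of k + 1 positions, and since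
-- removals commute every position contributes as much as the first. In the induction, x stands
-- first (`self`) or a block y does (`others`); `swap` then moves x in front of y.
ordered-∷ : ∀ {n} (x : Subset n) xs k U →
  ordered (x ∷ xs) (suc k) U ≡ ordered xs (suc k) U + suc k * maybe (ordered xs k) 0 (extract 2 x U)
ordered-∷ x xs zero U = trans (+-comm _ (ordered xs 1 U)) (cong (ordered xs 1 U +_) (sym (*-identityˡ _)))
ordered-∷ x xs (suc k) U = begin
  maybe (ordered (x ∷ xs) (suc k)) 0 (extract 2 x U) + ∑ xs (λ y → maybe (ordered (x ∷ xs) (suc k)) 0 (extract 2 y U))
    ≡⟨ cong₂ _+_ self (∑-cong xs (λ y → others y (extract 2 y U))) ⟩
  F + ∑ xs (λ y → maybe (ordered xs (suc k)) 0 (extract 2 y U)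
                  + suc k * maybe (λ V → maybe (ordered xs k) 0 (extract 2 x V)) 0 (extract 2 y U))
    ≡⟨ cong (F +_) (∑-+-* xs _ _ (suc k)) ⟩
  F + (G + suc k * ∑ xs (λ y → maybe (λ V → maybe (ordered xs k) 0 (extract 2 x V)) 0 (extract 2 y U)))
    ≡⟨ cong (λ t → F + (G + suc k * t)) (trans (∑-cong xs swap) (∑-maybe xs (extract 2 x U) _)) ⟩
  F + (G + suc k * F)
    ≡⟨ solve 3 (λ f g k → f :+ (g :+ k :* f) := g :+ (con 1 :+ k) :* f) refl F G (suc k) ⟩
  G + suc (suc k) * F ∎
  where
  open ≡-Reasoning
  open ℕ-Solver
  F = maybe (ordered xs (suc k)) 0 (extract 2 x U)
  G = ordered xs (suc (suc k)) U
  self : maybe (ordered (x ∷ xs) (suc k)) 0 (extract 2 x U) ≡ F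
  self with extract 2 x U in eq
  ... | nothing = refl
  -- Once x has been removed it cannot be removed again, so the extra term of the induction
  -- hypothesis vanishes.
  ... | just V  = trans (ordered-∷ x xs k V) (trans
    (cong (λ m → ordered xs (suc k) V + suc k * maybe (ordered xs k) 0 m) (extract-twice 1 x U eq))
    (trans (cong (ordered xs (suc k) V +_) (*-zeroʳ (suc k))) (+-identityʳ _)))
  others : ∀ y m → maybe (ordered (x ∷ xs) (suc k)) 0 m ≡
           maybe (ordered xs (suc k)) 0 m + suc k * maybe (λ V → maybe (ordered xs k) 0 (extract 2 x V)) 0 m
  others y nothing  = sym (*-zeroʳ (suc k))
  others y (just V) = ordered-∷ x xs k V
  swap : ∀ y → maybe (λ V → maybe (ordered xs k) 0 (extract 2 x V)) 0 (extract 2 y U) ≡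
               maybe (λ V → maybe (ordered xs k) 0 (extract 2 y V)) 0 (extract 2 x U)
  swap y = trans (maybe->>= (extract 2 y U) (extract 2 x) (ordered xs k)) (trans
    (cong (maybe (ordered xs k) 0) (extract-comm 2 y x U))
    (sym (maybe->>= (extract 2 x U) (extract 2 y) (ordered xs k))))

!*unordered≡ordered : ∀ {n} (xs : List (Subset n)) k U → k ! * unordered xs k U ≡ ordered xs k U
!*unordered≡ordered []       zero    U = *-identityˡ _
!*unordered≡ordered []       (suc k) U = *-zeroʳ (suc k !)
!*unordered≡ordered (x ∷ xs) zero    U = !*unordered≡ordered xs zero U
!*unordered≡ordered (x ∷ xs) (suc k) U = begin
  suc k ! * (unordered xs (suc k) U + maybe (unordered xs k) 0 m)
    ≡⟨ *-distribˡ-+ (suc k !) (unordered xs (suc k) U) _ ⟩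
  suc k ! * unordered xs (suc k) U + suc k * k ! * maybe (unordered xs k) 0 m
    ≡⟨ cong₂ _+_ (!*unordered≡ordered xs (suc k) U) (*-assoc (suc k) (k !) _) ⟩
  ordered xs (suc k) U + suc k * (k ! * maybe (unordered xs k) 0 m)
    ≡⟨ cong (λ t → ordered xs (suc k) U + suc k * t) (rest m) ⟩
  ordered xs (suc k) U + suc k * maybe (ordered xs k) 0 m
    ≡⟨ ordered-∷ x xs k U ⟨
  ordered (x ∷ xs) (suc k) U ∎
  where
  open ≡-Reasoning
  m = extract 2 x U
  rest : ∀ m → k ! * maybe (unordered xs k) 0 m ≡ maybe (ordered xs k) 0 m
  rest nothing  = *-zeroʳ (k !)
  rest (just V) = !*unordered≡ordered xs k V

-- From partitions to functions with large fibres

-- `IsPartition` with ⊤ replaced by any U: without its first block, a partition of U partitions only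
-- the rest of U.
PartitionOf : ∀ {n} → Subset n → ℕ → List (Subset n) → Set
PartitionOf U k 𝓑 = length 𝓑 ≡ k × All (λ B → 1 < ∣ B ∣) 𝓑 × AllPairs Disjoint 𝓑 × ⋃ 𝓑 ≡ U

partitionOf? : ∀ {n} (U : Subset n) k → Decidable (PartitionOf U k)
partitionOf? U k 𝓑 = length 𝓑 ≟ k ×-dec all? (λ B → 1 <? ∣ B ∣) 𝓑 ×-dec
  allPairs? (λ p q → ¬? (nonempty? (p ∩ q))) 𝓑 ×-dec ≡-dec _≟ᵇ_ (⋃ 𝓑) U


remove-∪ : ∀ {n} (x V : Subset n) → Disjoint x V → remove x (x ∪ V) ≡ just V
remove-∪ []            []            d = refl
remove-∪ (outside ∷ x) (b ∷ V)       d = cong (Maybe.map (b ∷_)) (remove-∪ x V (λ (i , i∈) → d (suc i , there i∈)))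
remove-∪ (inside ∷ x)  (outside ∷ V) d = cong (Maybe.map (outside ∷_)) (remove-∪ x V (λ (i , i∈) → d (suc i , there i∈)))
remove-∪ (inside ∷ x)  (inside ∷ V)  d = ⊥-elim (d (zero , here))

remove-just : ∀ {n} (x U : Subset n) {V} → remove x U ≡ just V → x ∪ V ≡ U × Disjoint x V
remove-just [] [] refl = refl , λ ()
remove-just (outside ∷ x) (b ∷ U) eq with remove x U in eq′
remove-just (outside ∷ x) (b ∷ U) refl | just V with remove-just x U eq′
... | ∪≡ , d = cong (b ∷_) ∪≡ , λ { (suc i , there i∈) → d (i , i∈) }
remove-just (inside ∷ x) (inside ∷ U) eq with remove x U in eq′
remove-just (inside ∷ x) (inside ∷ U) refl | just V with remove-just x U eq′
... | ∪≡ , d = cong (inside ∷_) ∪≡ , λ { (suc i , there i∈) → d (i , i∈) }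

Disjoint-⋃⁺ : ∀ {n} (x : Subset n) {𝓑} → All (Disjoint x) 𝓑 → Disjoint x (⋃ 𝓑)
Disjoint-⋃⁺ x [] (i , i∈) = ∉⊥ (proj₂ (x∈p∩q⁻ x ⊥ i∈))
Disjoint-⋃⁺ x {B ∷ 𝓑} (d ∷ ds) (i , i∈) with x∈p∩q⁻ x (B ∪ ⋃ 𝓑) i∈
... | i∈x , i∈∪ with x∈p∪q⁻ B (⋃ 𝓑) i∈∪
...   | inj₁ i∈B = d (i , x∈p∩q⁺ (i∈x , i∈B))
...   | inj₂ i∈⋃ = Disjoint-⋃⁺ x ds (i , x∈p∩q⁺ (i∈x , i∈⋃))

Disjoint-⋃⁻ : ∀ {n} (x : Subset n) 𝓑 → Disjoint x (⋃ 𝓑) → All (Disjoint x) 𝓑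
Disjoint-⋃⁻ x []      d = []
Disjoint-⋃⁻ x (B ∷ 𝓑) d =
  (λ (i , i∈) → let i∈x , i∈B = x∈p∩q⁻ x B i∈ in d (i , x∈p∩q⁺ (i∈x , x∈p∪q⁺ (inj₁ i∈B)))) ∷
  Disjoint-⋃⁻ x 𝓑 (λ (i , i∈) →
    let i∈x , i∈⋃ = x∈p∩q⁻ x (⋃ 𝓑) i∈ in d (i , x∈p∩q⁺ (i∈x , x∈p∪q⁺ (inj₂ i∈⋃))))

PartitionOf-extract : ∀ {n} (U x : Subset n) k 𝓑 → PartitionOf U (suc k) (x ∷ 𝓑) →
                      extract 2 x U ≡ just (⋃ 𝓑)
PartitionOf-extract U x k 𝓑 (_ , 1<x ∷ _ , d ∷ _ , refl) =
  trans (extract-≤ 2 x (x ∪ ⋃ 𝓑) 1<x) (remove-∪ x (⋃ 𝓑) (Disjoint-⋃⁺ x d))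

∣p∣≡0⇒p≡⊥ : ∀ {n} (U : Subset n) → ∣ U ∣ ≡ 0 → U ≡ ⊥
∣p∣≡0⇒p≡⊥ []            eq = refl
∣p∣≡0⇒p≡⊥ (outside ∷ U) eq = cong (outside ∷_) (∣p∣≡0⇒p≡⊥ U eq)

-- A sublist of x ∷ xs omits x or begins with x; in the second case its tail partitions what
-- `extract` leaves, and there is none if `extract` fails.
count-partitionOf : ∀ {n} (xs : List (Subset n)) k U → count (partitionOf? U k) (sublists xs) ≡ unordered xs k U
count-partitionOf {n} [] zero U with ∣ U ∣ in eq
-- `0 ^ ∣ U ∣` is 1 or 0 according to whether U is empty, that is, whether the empty family
-- partitions U.
... | zero  = cong length (filter-accept (partitionOf? U 0) {[]} {[]} (refl , [] , [] , sym (∣p∣≡0⇒p≡⊥ U eq)))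
... | suc _ = cong length (filter-reject (partitionOf? U 0) {[]} {[]} (λ (_ , _ , _ , ⊥≡U) →
  case trans (sym eq) (trans (cong ∣_∣ (sym ⊥≡U)) (∣⊥∣≡0 n)) of λ ()))
count-partitionOf [] (suc k) U = cong length (filter-reject (partitionOf? U (suc k)) {[]} {[]} (λ { (() , _) }))
count-partitionOf (x ∷ xs) k U = trans (count-++ (partitionOf? U k) (sublists xs) _) (go k)
  where
  go : ∀ k → count (partitionOf? U k) (sublists xs) + count (partitionOf? U k) (map (x ∷_) (sublists xs))
             ≡ unordered (x ∷ xs) k U
  go zero = trans (cong₂ _+_ (count-partitionOf xs zero U)
    (count-map-none (partitionOf? U 0) (x ∷_) (λ { 𝓑 (() , _) }) (sublists xs))) (+-identityʳ _)
  go (suc k) = cong₂ _+_ (count-partitionOf xs (suc k) U) with-x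
    where
    with-x : count (partitionOf? U (suc k)) (map (x ∷_) (sublists xs)) ≡ maybe (unordered xs k) 0 (extract 2 x U)
    with-x with extract 2 x U in eq
    ... | nothing = count-map-none (partitionOf? U (suc k)) (x ∷_)
      (λ 𝓑 P → case trans (sym eq) (PartitionOf-extract U x k 𝓑 P) of λ ()) (sublists xs)
    ... | just V = trans
      (count-map (partitionOf? U (suc k)) (partitionOf? V k) (x ∷_) to from (sublists xs))
      (count-partitionOf xs k V)
      where
      to : ∀ 𝓑 → PartitionOf U (suc k) (x ∷ 𝓑) → PartitionOf V k 𝓑
      to 𝓑 P@(l , _ ∷ s , _ ∷ d , _) = suc-injective l , s , d ,
        just-injective (trans (sym (PartitionOf-extract U x k 𝓑 P)) eq)
      from : ∀ 𝓑 → PartitionOf V k 𝓑 → PartitionOf U (suc k) (x ∷ 𝓑)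
      from 𝓑 (l , s , d , refl) with extract-just 2 x U eq
      ... | 1<x , eq′ with remove-just x U eq′
      ...   | ∪≡ , dis = cong suc l , 1<x ∷ s , Disjoint-⋃⁻ x 𝓑 dis ∷ d , ∪≡

-- τ i h u = Σ h (∣ U ∖ x ∣), summed over the subsets x with at least i elements of a u-element set U.

τ : ℕ → (ℕ → ℕ) → ℕ → ℕ
τ zero    h zero    = h 0
τ (suc i) h zero    = 0
τ i       h (suc u) = τ i (h ∘ suc) u + τ (pred i) h u

-- Induction on coordinates. A point outside U is forbidden to x. A point of U either stays in the
-- complement, turning h into h ∘ suc, or joins x, which then needs only pred i further points.
∑-subsets : ∀ {n} i (h : ℕ → ℕ) (U : Subset n) →
            ∑ (subsets n) (λ x → maybe (h ∘ ∣_∣) 0 (extract i x U)) ≡ τ i h ∣ U ∣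
∑-subsets zero    h [] = +-identityʳ (h 0)
∑-subsets (suc i) h [] = refl
∑-subsets {suc n} i h (b ∷ U) = trans (∑-++ (map (outside ∷_) (subsets n)) _ _) (trans
  (cong₂ _+_ (∑-map (subsets n) (outside ∷_) _) (∑-map (subsets n) (inside ∷_) _)) (by b))
  where
  maybe-map : ∀ g b m (c : Bool) → (∀ (V : Subset n) → h ∣ b ∷ V ∣ ≡ g ∣ V ∣) →
    maybe (h ∘ ∣_∣) 0 (guarded c (Maybe.map (b ∷_) m)) ≡ maybe (g ∘ ∣_∣) 0 (guarded {Subset n} c m)
  maybe-map g b m        false eq = refl
  maybe-map g b nothing  true  eq = refl
  maybe-map g b (just V) true  eq = eq V
  guarded-nothing : ∀ c → maybe (h ∘ ∣_∣) 0 (guarded {Subset (suc n)} c nothing) ≡ 0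
  guarded-nothing false = refl
  guarded-nothing true  = refl
  ≤ᵇ-pred : ∀ i m → (i ≤ᵇ suc m) ≡ (pred i ≤ᵇ m)
  ≤ᵇ-pred zero          m = refl
  ≤ᵇ-pred (suc zero)    m = refl
  ≤ᵇ-pred (suc (suc i)) m = refl
  by : ∀ b → ∑ (subsets n) (λ x → maybe (h ∘ ∣_∣) 0 (extract i (outside ∷ x) (b ∷ U))) +
             ∑ (subsets n) (λ x → maybe (h ∘ ∣_∣) 0 (extract i (inside ∷ x) (b ∷ U))) ≡ τ i h ∣ b ∷ U ∣
  by outside = trans (cong₂ _+_
    (trans (∑-cong (subsets n) (λ x → maybe-map h outside (remove x U) (i ≤ᵇ ∣ x ∣) (λ _ → refl))) (∑-subsets i h U))
    (trans (∑-cong (subsets n) (λ x → guarded-nothing (i ≤ᵇ suc ∣ x ∣))) (∑-zero (subsets n))))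
    (+-identityʳ _)
  by inside = trans (cong₂ _+_
    (trans (∑-cong (subsets n) (λ x → maybe-map (h ∘ suc) inside (remove x U) (i ≤ᵇ ∣ x ∣) (λ _ → refl)))
           (∑-subsets i (h ∘ suc) U))
    (trans (∑-cong (subsets n) (λ x → trans
              (maybe-map h outside (remove x U) (i ≤ᵇ suc ∣ x ∣) (λ _ → refl))
              (cong (λ c → maybe (h ∘ ∣_∣) 0 (guarded c (remove x U))) (≤ᵇ-pred i ∣ x ∣))))
           (∑-subsets (pred i) h U)))
    (τ-suc i)
    where
    τ-suc : ∀ i → τ i (h ∘ suc) ∣ U ∣ + τ (pred i) h ∣ U ∣ ≡ τ i h (suc ∣ U ∣)
    τ-suc zero    = refl
    τ-suc (suc i) = refl

-- W k u is the number of functions from a u-element set to a k-element set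
-- all of whose fibres have at least two elements.
W : ℕ → ℕ → ℕ
W zero    u = 0 ^ u
W (suc k) u = τ 2 (W k) u

ordered-subsets : ∀ {n} k (U : Subset n) → ordered (subsets n) k U ≡ W k ∣ U ∣
ordered-subsets     zero    U = refl
ordered-subsets {n} (suc k) U = trans
  (∑-cong (subsets n) (λ x → maybe-cong (extract 2 x U))) (∑-subsets 2 (W k) U)
  where
  maybe-cong : ∀ m → maybe (ordered (subsets n) k) 0 m ≡ maybe (W k ∘ ∣_∣) 0 m
  maybe-cong nothing  = refl
  maybe-cong (just V) = ordered-subsets k V

!*D≡W : ∀ n k → k ! * D n k ≡ W k n
!*D≡W n k = begin
  -- Mapping `id` allows `count-map` to exchange the two predicates.
  k ! * D n k                                     ≡⟨ cong (λ xs → k ! * count (isPartition? k) xs) (map-id (sublists (subsets n))) ⟨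
  k ! * count (isPartition? k) (map id (sublists (subsets n)))
    ≡⟨ cong (k ! *_) (count-map (isPartition? k) (partitionOf? ⊤ k) id
         (λ _ (mkIsPartition a b c d) → a , b , c , d) (λ _ (a , b , c , d) → mkIsPartition a b c d)
         (sublists (subsets n))) ⟩
  k ! * count (partitionOf? ⊤ k) (sublists (subsets n)) ≡⟨ cong (k ! *_) (count-partitionOf (subsets n) k ⊤) ⟩
  k ! * unordered (subsets n) k ⊤                 ≡⟨ !*unordered≡ordered (subsets n) k ⊤ ⟩
  ordered (subsets n) k ⊤                         ≡⟨ ordered-subsets k ⊤ ⟩
  W k ∣ ⊤ {n} ∣                                   ≡⟨ cong (W k) (∣⊤∣≡n n) ⟩
  W k n ∎
  where open ≡-Reasoning

-- Estimates for W

τ-mono : ∀ i {f g : ℕ → ℕ} → (∀ u → f u ≤ g u) → ∀ u → τ i f u ≤ τ i g u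
τ-mono zero    f≤g zero    = f≤g 0
τ-mono (suc i) f≤g zero    = z≤n
τ-mono zero    f≤g (suc u) = +-mono-≤ (τ-mono zero (f≤g ∘ suc) u) (τ-mono zero f≤g u)
τ-mono (suc i) f≤g (suc u) = +-mono-≤ (τ-mono (suc i) (f≤g ∘ suc) u) (τ-mono i f≤g u)

τ-+-* : ∀ i (f g : ℕ → ℕ) c u → τ i (λ v → f v + c * g v) u ≡ τ i f u + c * τ i g u
τ-+-* zero    f g c zero = refl
τ-+-* (suc i) f g c zero = sym (*-zeroʳ c)
τ-+-* i f g c (suc u) = step i
  where
  open ℕ-Solver
  shuffle = solve 5 (λ a b c d e → a :+ c :* b :+ (d :+ c :* e) := a :+ d :+ c :* (b :+ e)) refl
  step : ∀ i → τ i (λ v → f v + c * g v) (suc u) ≡ τ i f (suc u) + c * τ i g (suc u)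
  step zero    = trans (cong₂ _+_ (τ-+-* zero (f ∘ suc) (g ∘ suc) c u) (τ-+-* zero f g c u))
    (shuffle (τ 0 (f ∘ suc) u) (τ 0 (g ∘ suc) u) c (τ 0 f u) (τ 0 g u))
  step (suc i) = trans (cong₂ _+_ (τ-+-* (suc i) (f ∘ suc) (g ∘ suc) c u) (τ-+-* i f g c u))
    (shuffle (τ (suc i) (f ∘ suc) u) (τ (suc i) (g ∘ suc) u) c (τ i f u) (τ i g u))

τ-zero : ∀ i u → τ i (λ _ → 0) u ≡ 0
τ-zero zero    zero    = refl
τ-zero (suc i) zero    = refl
τ-zero zero    (suc u) = cong₂ _+_ (τ-zero 0 u) (τ-zero 0 u)
τ-zero (suc i) (suc u) = cong₂ _+_ (τ-zero (suc i) u) (τ-zero i u)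

τ-* : ∀ i (g : ℕ → ℕ) c u → τ i (λ v → c * g v) u ≡ c * τ i g u
τ-* i g c u = trans (τ-+-* i (λ _ → 0) g c u) (cong (_+ c * τ i g u) (τ-zero i u))

-- dpow a u = u aᵘ⁻¹
dpow : ℕ → ℕ → ℕ
dpow a zero    = 0
dpow a (suc u) = a ^ u + a * dpow a u

*-dpow : ∀ a u → a * dpow a u ≡ u * a ^ u
*-dpow a zero    = *-zeroʳ a
*-dpow a (suc u) = trans (*-distribˡ-+ a (a ^ u) (a * dpow a u)) (cong (a ^ suc u +_)
  (trans (cong (a *_) (*-dpow a u))
    (solve 3 (λ a u x → a :* (u :* x) := u :* (a :* x)) refl a u (a ^ u))))
  where open ℕ-Solver

-- The binomial theorem: a function to a + 1 points is the fibre x over one of them and a function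
-- from the rest to the other a.
τ0-pow : ∀ a u → τ 0 (a ^_) u ≡ suc a ^ u
τ0-pow a zero    = refl
τ0-pow a (suc u) = trans (cong (_+ τ 0 (a ^_) u) (τ-* 0 (a ^_) a u))
  (trans (+-comm _ (τ 0 (a ^_) u)) (cong (suc a *_) (τ0-pow a u)))

-- The derivative of the binomial theorem with respect to a.
τ0-dpow : ∀ a u → τ 0 (dpow a) u ≡ dpow (suc a) u
τ0-dpow a zero    = refl
τ0-dpow a (suc u) = trans (cong₂ _+_ (τ-+-* 0 (a ^_) (dpow a) a u) refl) (trans
  (cong₂ (λ x y → x + a * y + y) (τ0-pow a u) (τ0-dpow a u))
  (solve 3 (λ a x y → x :+ a :* y :+ y := x :+ (con 1 :+ a) :* y) refl a (suc a ^ u) (dpow (suc a) u)))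
  where open ℕ-Solver

-- Σ h (∣ U ∖ x ∣) over the one-element subsets x of U, where ∣ U ∣ = u
singletons : (ℕ → ℕ) → ℕ → ℕ
singletons h zero    = 0
singletons h (suc u) = singletons (h ∘ suc) u + h u

singletons-pow : ∀ a u → singletons (a ^_) u ≡ dpow a u
singletons-pow a zero    = refl
singletons-pow a (suc u) = trans (+-comm _ (a ^ u)) (cong (a ^ u +_)
  (trans (singletons-* (a ^_) u) (cong (a *_) (singletons-pow a u))))
  where
  singletons-* : ∀ h u → singletons (λ v → a * h v) u ≡ a * singletons h u
  singletons-* h zero    = sym (*-zeroʳ a)
  singletons-* h (suc u) = trans (cong (_+ a * h u) (singletons-* (h ∘ suc) u))
    (sym (*-distribˡ-+ a (singletons (h ∘ suc) u) (h u)))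

-- The empty x is the only one lost, and it leaves all u elements. Likewise the next lemma loses the
-- one-element sets.
τ0≡τ1+ : ∀ h u → τ 0 h u ≡ τ 1 h u + h u
τ0≡τ1+ h zero    = refl
τ0≡τ1+ h (suc u) = trans (cong (_+ τ 0 h u) (τ0≡τ1+ (h ∘ suc) u))
  (solve 3 (λ a b c → a :+ b :+ c := a :+ c :+ b) refl (τ 1 (h ∘ suc) u) (h (suc u)) (τ 0 h u))
  where open ℕ-Solver

τ1≡τ2+ : ∀ h u → τ 1 h u ≡ τ 2 h u + singletons h u
τ1≡τ2+ h zero    = refl
τ1≡τ2+ h (suc u) = trans (cong₂ _+_ (τ1≡τ2+ (h ∘ suc) u) (τ0≡τ1+ h u))
  (solve 4 (λ a b c d → a :+ b :+ (c :+ d) := a :+ c :+ (b :+ d)) refl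
    (τ 2 (h ∘ suc) u) (singletons (h ∘ suc) u) (τ 1 h u) (h u))
  where open ℕ-Solver

τ0≡τ2+ : ∀ h u → τ 0 h u ≡ τ 2 h u + (singletons h u + h u)
τ0≡τ2+ h u = trans (τ0≡τ1+ h u) (trans (cong (_+ h u) (τ1≡τ2+ h u)) (+-assoc (τ 2 h u) _ _))

τ2≤τ0 : ∀ h u → τ 2 h u ≤ τ 0 h u
τ2≤τ0 h u = ≤-trans (m≤m+n _ _) (≤-reflexive (sym (τ0≡τ2+ h u)))

W≤pow : ∀ k u → W k u ≤ k ^ u
W≤pow zero    u = ≤-refl
W≤pow (suc k) u = begin
  τ 2 (W k) u   ≤⟨ τ2≤τ0 (W k) u ⟩
  τ 0 (W k) u   ≤⟨ τ-mono 0 (W≤pow k) u ⟩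
  τ 0 (k ^_) u  ≡⟨ τ0-pow k u ⟩
  suc k ^ u     ∎
  where open ≤-Reasoning

-- The union bound over the points whose fibre has at most one element.
pow≤W+ : ∀ k u → k ^ u ≤ W k u + k * (pred k ^ u + dpow (pred k) u)
pow≤W+ zero    u = ≤-reflexive (sym (+-identityʳ (0 ^ u)))
pow≤W+ (suc k) u = begin
  suc k ^ u
    ≡⟨ τ0-pow k u ⟨
  τ 0 (k ^_) u
    ≡⟨ τ0≡τ2+ (k ^_) u ⟩
  τ 2 (k ^_) u + (singletons (k ^_) u + k ^ u)
    -- The bracket counts the functions whose fibre over the new point is small. The induction
    -- hypothesis covers the k old points, after which the new fibre may be arbitrary, so τ 2 is
    -- relaxed to τ 0.
    ≤⟨ +-monoˡ-≤ _ (τ-mono 2 (pow≤W+ k) u) ⟩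
  τ 2 (λ v → W k v + k * bad v) u + (singletons (k ^_) u + k ^ u)
    ≡⟨ cong₂ _+_ (τ-+-* 2 (W k) bad k u) (cong (_+ k ^ u) (singletons-pow k u)) ⟩
  W (suc k) u + k * τ 2 bad u + (dpow k u + k ^ u)
    ≤⟨ +-monoˡ-≤ _ (+-monoʳ-≤ (W (suc k) u) (*-monoʳ-≤ k (τ2≤τ0 bad u))) ⟩
  W (suc k) u + k * τ 0 bad u + (dpow k u + k ^ u)
    ≡⟨ cong (λ t → W (suc k) u + t + (dpow k u + k ^ u)) (total k) ⟩
  W (suc k) u + k * (k ^ u + dpow k u) + (dpow k u + k ^ u)
    ≡⟨ solve 4 (λ w k x y → w :+ k :* (x :+ y) :+ (y :+ x) := w :+ (con 1 :+ k) :* (x :+ y)) refl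
         (W (suc k) u) k (k ^ u) (dpow k u) ⟩
  W (suc k) u + suc k * (k ^ u + dpow k u) ∎
  where
  open ≤-Reasoning
  open ℕ-Solver
  bad : ℕ → ℕ
  bad v = pred k ^ v + dpow (pred k) v
  -- The factor k stays on both sides because the sums differ at k = 0, where pred 0 is 0.
  total : ∀ k → k * τ 0 (λ v → pred k ^ v + dpow (pred k) v) u ≡ k * (k ^ u + dpow k u)
  total zero    = refl
  total (suc k) = cong (suc k *_) (trans
    (trans (τ-cong (λ v → cong (k ^ v +_) (sym (*-identityˡ (dpow k v))))) (τ-+-* 0 (k ^_) (dpow k) 1 u))
    (cong₂ _+_ (τ0-pow k u) (trans (*-identityˡ _) (τ0-dpow k u))))
    where
    τ-cong : ∀ {f g : ℕ → ℕ} → (∀ v → f v ≡ g v) → τ 0 f u ≡ τ 0 g u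
    τ-cong eq = ≤-antisym (τ-mono 0 (λ v → ≤-reflexive (eq v)) u) (τ-mono 0 (λ v → ≤-reflexive (sym (eq v))) u)

*-interchange : ∀ x y z w → x * y * (z * w) ≡ x * z * (y * w)
*-interchange = solve-∀

^-distribʳ-* : ∀ n a b → (a * b) ^ n ≡ a ^ n * b ^ n
^-distribʳ-* zero    a b = refl
^-distribʳ-* (suc n) a b = trans (cong (a * b *_) (^-distribʳ-* n a b)) (*-interchange a b (a ^ n) (b ^ n))

-- Comparison of the fractions a/b and c/d without division

infix 4 _∕_≼_∕_

record _∕_≼_∕_ (a b c d : ℕ) : Set where
  constructor mk≼
  field
    cross : a * d ≤ c * b

open _∕_≼_∕_ public

≼-trans : ∀ {a b} c d {e f} .{{_ : NonZero d}} → a ∕ b ≼ c ∕ d → c ∕ d ≼ e ∕ f → a ∕ b ≼ e ∕ f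
≼-trans {a} {b} c d {e} {f} (mk≼ ad≤cb) (mk≼ cf≤ed) = mk≼ (*-cancelʳ-≤ (a * f) (e * b) d (begin
  a * f * d  ≡⟨ swap a f d ⟩
  a * d * f  ≤⟨ *-monoˡ-≤ f ad≤cb ⟩
  c * b * f  ≡⟨ swap c b f ⟩
  c * f * b  ≤⟨ *-monoˡ-≤ b cf≤ed ⟩
  e * d * b  ≡⟨ swap e d b ⟩
  e * b * d  ∎))
  where
  open ≤-Reasoning
  swap : ∀ x y z → x * y * z ≡ x * z * y
  swap = solve-∀

≼-* : ∀ {a b c d a′ b′ c′ d′} → a ∕ b ≼ c ∕ d → a′ ∕ b′ ≼ c′ ∕ d′ → a * a′ ∕ b * b′ ≼ c * c′ ∕ d * d′
≼-* {a} {b} {c} {d} {a′} {b′} {c′} {d′} (mk≼ p) (mk≼ q) =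
  mk≼ (subst₂ _≤_ (*-interchange a d a′ d′) (*-interchange c b c′ b′) (*-mono-≤ p q))

≼-^ : ∀ {a b c d} → a ∕ b ≼ c ∕ d → ∀ n → a ^ n ∕ b ^ n ≼ c ^ n ∕ d ^ n
≼-^ {a} {b} {c} {d} (mk≼ p) n = mk≼ (subst₂ _≤_ (^-distribʳ-* n a d) (^-distribʳ-* n c b) (^-monoˡ-≤ n p))

≼-^-exp : ∀ {a b m n} → a ≤ b → m ≤ n → b ^ m ∕ a ^ m ≼ b ^ n ∕ a ^ n
≼-^-exp {a} {b} {m} a≤b m≤n with m≤n⇒∃[o]m+o≡n m≤n
... | k , refl = mk≼ (begin
  b ^ m * a ^ (m + k)      ≡⟨ cong (b ^ m *_) (^-distribˡ-+-* a m k) ⟩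
  b ^ m * (a ^ m * a ^ k)  ≤⟨ *-monoʳ-≤ (b ^ m) (*-monoʳ-≤ (a ^ m) (^-monoˡ-≤ k a≤b)) ⟩
  b ^ m * (a ^ m * b ^ k)  ≡⟨ swap (b ^ m) (a ^ m) (b ^ k) ⟩
  b ^ m * b ^ k * a ^ m    ≡⟨ cong (_* a ^ m) (^-distribˡ-+-* b m k) ⟨
  b ^ (m + k) * a ^ m      ∎)
  where
  open ≤-Reasoning
  swap : ∀ x y z → x * (y * z) ≡ x * z * y
  swap = solve-∀

-- The approximations (1 + 1/k)ᵏ ≤ e ≤ (1 + 1/k)ᵏ⁺¹

bernoulli : ∀ a b n → (a + n * b) * a ^ n ≤ a * (a + b) ^ n
bernoulli a b zero    = ≤-reflexive (base a)
  where
  base : ∀ a → (a + 0) * 1 ≡ a * 1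
  base = solve-∀
bernoulli a b (suc n) = begin
  (a + suc n * b) * (a * a ^ n)                  ≤⟨ m≤m+n _ (n * b * b * a ^ n) ⟩
  (a + suc n * b) * (a * a ^ n) + n * b * b * a ^ n  ≡⟨ eq₁ a b n (a ^ n) ⟩
  (a + b) * ((a + n * b) * a ^ n)                ≤⟨ *-monoʳ-≤ (a + b) (bernoulli a b n) ⟩
  (a + b) * (a * (a + b) ^ n)                    ≡⟨ eq₂ (a + b) a ((a + b) ^ n) ⟩
  a * ((a + b) * (a + b) ^ n)                    ∎
  where
  open ≤-Reasoning
  eq₁ : ∀ a b n x → (a + suc n * b) * (a * x) + n * b * b * x ≡ (a + b) * ((a + n * b) * x)
  eq₁ = solve-∀
  eq₂ : ∀ c a x → c * (a * x) ≡ a * (c * x)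
  eq₂ = solve-∀

-- Bernoulli's inequality for 1 + 1/(k(k+2)) = (k+1)²/(k(k+2)).
upper-step : ∀ k .{{_ : NonZero k}} →
  suc (suc k) ^ suc (suc k) ∕ suc k ^ suc (suc k) ≼ suc k ^ suc k ∕ k ^ suc k
upper-step k = mk≼ (*-cancelˡ-≤ a {{m*n≢0 k (2 + k)}} (begin
  a * (suc (suc k) * suc (suc k) ^ suc k * k ^ suc k)
    ≡⟨ cong (a *_) (eq₀ (suc (suc k)) (suc (suc k) ^ suc k) (k ^ suc k)) ⟩
  a * (suc (suc k) * (k ^ suc k * suc (suc k) ^ suc k))
    ≡⟨ cong (λ t → a * (suc (suc k) * t)) (^-distribʳ-* (suc k) k (2 + k)) ⟨
  a * (suc (suc k) * a ^ suc k)
    -- The slack is exactly one unit: (k + 1)(a + k + 1) = (k + 2)a + 1 for a = k(k + 2).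
    ≤⟨ m≤m+n _ (a ^ suc k) ⟩
  a * (suc (suc k) * a ^ suc k) + a ^ suc k
    ≡⟨ eq₁ k (a ^ suc k) ⟩
  suc k * ((a + suc k * 1) * a ^ suc k)
    ≤⟨ *-monoʳ-≤ (suc k) (bernoulli a 1 (suc k)) ⟩
  suc k * (a * (a + 1) ^ suc k)
    ≡⟨ cong (λ t → suc k * (a * t)) (trans (cong (_^ suc k) (eq₂ k)) (^-distribʳ-* (suc k) (suc k) (suc k))) ⟩
  suc k * (a * (suc k ^ suc k * suc k ^ suc k))
    ≡⟨ eq₃ (suc k) a (suc k ^ suc k) ⟩
  a * (suc k ^ suc k * (suc k * suc k ^ suc k)) ∎))
  where
  open ≤-Reasoning
  a = k * (2 + k)
  eq₀ : ∀ x y z → x * y * z ≡ x * (z * y)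
  eq₀ = solve-∀
  eq₁ : ∀ k x → k * (2 + k) * ((2 + k) * x) + x ≡ (1 + k) * ((k * (2 + k) + (1 + k) * 1) * x)
  eq₁ = solve-∀
  eq₂ : ∀ k → k * (2 + k) + 1 ≡ (1 + k) * (1 + k)
  eq₂ = solve-∀
  eq₃ : ∀ s a x → s * (a * (x * x)) ≡ a * (x * (s * x))
  eq₃ = solve-∀

upper-antitone : ∀ {k m} .{{_ : NonZero k}} → k ≤ m → suc m ^ suc m ∕ m ^ suc m ≼ suc k ^ suc k ∕ k ^ suc k
upper-antitone {k} k≤m = go (≤⇒≤′ k≤m)
  where
  go : ∀ {m} → k ≤′ m → suc m ^ suc m ∕ m ^ suc m ≼ suc k ^ suc k ∕ k ^ suc k
  go ≤′-refl = mk≼ ≤-refl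
  go {suc m} (≤′-step k≤′m) = ≼-trans (suc m ^ suc m) (m ^ suc m) {{m^n≢0 m (suc m)}} (upper-step m) (go k≤′m)
    where instance
      m≢0 : NonZero m
      m≢0 = >-nonZero (<-≤-trans (>-nonZero⁻¹ k) (≤′⇒≤ k≤′m))

-- Instead of passing through e, both sides meet at the common multiple m = kt. Bernoulli gives 1 +
-- 1/t ≤ (1 + 1/m)ᵏ, hence (1 + 1/t)ᵗ ≤ (1 + 1/m)ᵐ, and the upper approximations decrease from k to
-- m.
lower≼upper : ∀ t k .{{_ : NonZero t}} .{{_ : NonZero k}} → suc t ^ t ∕ t ^ t ≼ suc k ^ suc k ∕ k ^ suc k
lower≼upper t k = ≼-trans (suc m ^ m) (m ^ m) {{m^n≢0 m m}} step₁
  (≼-trans (suc m ^ suc m) (m ^ suc m) {{m^n≢0 m (suc m)}} step₂ (upper-antitone (m≤m*n k t)))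
  where
  open ≤-Reasoning
  m = k * t
  instance
    m≢0 : NonZero m
    m≢0 = m*n≢0 k t
  step₀ : suc t ∕ t ≼ suc m ^ k ∕ m ^ k
  step₀ = mk≼ (*-cancelˡ-≤ k (begin
    k * (suc t * m ^ k)    ≡⟨ eq₁ k t (m ^ k) ⟩
    (m + k * 1) * m ^ k    ≤⟨ bernoulli m 1 k ⟩
    m * (m + 1) ^ k        ≡⟨ cong (λ s → m * s ^ k) (+-comm m 1) ⟩
    m * suc m ^ k          ≡⟨ eq₂ k t (suc m ^ k) ⟩
    k * (suc m ^ k * t)    ∎))
    where
    eq₁ : ∀ k t x → k * ((1 + t) * x) ≡ (k * t + k * 1) * x
    eq₁ = solve-∀
    eq₂ : ∀ k t x → k * t * x ≡ k * (x * t)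
    eq₂ = solve-∀
  step₁ : suc t ^ t ∕ t ^ t ≼ suc m ^ m ∕ m ^ m
  step₁ = subst₂ (λ x y → suc t ^ t ∕ t ^ t ≼ x ∕ y) (^-*-assoc (suc m) k t) (^-*-assoc m k t) (≼-^ step₀ t)
  step₂ : suc m ^ m ∕ m ^ m ≼ suc m ^ suc m ∕ m ^ suc m
  step₂ = ≼-^-exp (n≤1+n m) (n≤1+n m)

2≼lower : ∀ t .{{_ : NonZero t}} → 2 ∕ 1 ≼ suc t ^ t ∕ t ^ t
2≼lower t = mk≼ (*-cancelˡ-≤ t (begin
  t * (2 * t ^ t)       ≡⟨ eq t (t ^ t) ⟩
  (t + t * 1) * t ^ t   ≤⟨ bernoulli t 1 t ⟩
  t * (t + 1) ^ t       ≡⟨ cong (t *_) (trans (cong (_^ t) (+-comm t 1)) (sym (*-identityʳ _))) ⟩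
  t * (suc t ^ t * 1)   ∎))
  where
  open ≤-Reasoning
  eq : ∀ t x → t * (2 * x) ≡ (t + t * 1) * x
  eq = solve-∀

-- Each factor (t + 1)/t is at most (s + 1)/s for s ≤ t, and the product over r ≤ s < t telescopes
-- to t/r.
[1+1/t]^i≼t/[t-i] : ∀ i r → suc (i + r) ^ i ∕ (i + r) ^ i ≼ i + r ∕ r
[1+1/t]^i≼t/[t-i] i r = mk≼ (go i r refl)
  where
  open ≤-Reasoning
  t = i + r
  go : ∀ j s → j + s ≡ t → suc t ^ j * s ≤ t * t ^ j
  go zero    s eq = ≤-reflexive (trans (*-identityˡ s) (trans eq (sym (*-identityʳ t))))
  go (suc j) s eq = begin
    suc t * suc t ^ j * s          ≡⟨ eq₁ t s (suc t ^ j) ⟩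
    suc t ^ j * (s + t * s)        ≤⟨ *-monoʳ-≤ (suc t ^ j) (+-monoˡ-≤ (t * s) (≤-trans (m≤n+m s (suc j)) (≤-reflexive eq))) ⟩
    suc t ^ j * (t + t * s)        ≡⟨ eq₂ t s (suc t ^ j) ⟩
    t * (suc t ^ j * suc s)        ≤⟨ *-monoʳ-≤ t (go j (suc s) (trans (+-suc j s) eq)) ⟩
    t * (t * t ^ j)                ∎
    where
    eq₁ : ∀ t s x → (1 + t) * x * s ≡ x * (s + t * s)
    eq₁ = solve-∀
    eq₂ : ∀ t s x → x * (t + t * s) ≡ t * (x * (1 + s))
    eq₂ = solve-∀

[1+1/2q]^q≼2 : ∀ q .{{_ : NonZero q}} → suc (q + q) ^ q ∕ (q + q) ^ q ≼ 2 ∕ 1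
[1+1/2q]^q≼2 q = ≼-trans (q + q) q ([1+1/t]^i≼t/[t-i] q q) (mk≼ (≤-reflexive (eq q)))
  where
  eq : ∀ q → (q + q) * 1 ≡ 2 * q
  eq = solve-∀

-- Ratios of consecutive values of kⁿ/k!

module Ratio (n q ω C : ℕ) .{{q≢0 : NonZero q}}
  (8n≼ : 8 * n ∕ 1 ≼ suc (q + q) ^ ((q + q) * (q * ω)) ∕ (q + q) ^ ((q + q) * (q * ω)))
  (≼8nC : suc (q + q) ^ ((q + q) * (q * ω)) ∕ (q + q) ^ ((q + q) * (q * ω)) ≼ 8 * n * C ∕ 1)
  (8CΛ≤2^ω : 8 * C * (q * ω) ≤ 2 ^ ω)
  where

  T Λ : ℕ
  T = q + q
  Λ = q * ω

  open ≤-Reasoning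

  instance
    T≢0 : NonZero T
    T≢0 = >-nonZero (≤-trans (>-nonZero⁻¹ q) (m≤m+n q q))

  -- (1 + 1/j)ⁿ ≥ ((1 + 1/j)ʲ⁺¹)^Λ ≥ (1 + 1/T)^(TΛ) ≥ 8n. This serves both the union bound and the
  -- rise of g below k₀.
  growth : ∀ j .{{_ : NonZero j}} → suc j * Λ ≤ n → 8 * n * j ^ n ≤ suc j ^ n
  growth j Λ≤n = subst (8 * n * j ^ n ≤_) (*-identityʳ _) (cross
    (≼-trans (suc T ^ (T * Λ)) (T ^ (T * Λ)) {{m^n≢0 T (T * Λ)}} 8n≼
    (≼-trans (suc j ^ (suc j * Λ)) (j ^ (suc j * Λ)) {{m^n≢0 j (suc j * Λ)}} lower^Λ
      (≼-^-exp (n≤1+n j) Λ≤n))))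
    where
    lower^Λ : suc T ^ (T * Λ) ∕ T ^ (T * Λ) ≼ suc j ^ (suc j * Λ) ∕ j ^ (suc j * Λ)
    lower^Λ = subst₂ (λ x y → x ∕ y ≼ suc j ^ (suc j * Λ) ∕ j ^ (suc j * Λ)) (^-*-assoc (suc T) T Λ) (^-*-assoc T T Λ)
      (subst₂ (λ x y → (suc T ^ T) ^ Λ ∕ (T ^ T) ^ Λ ≼ x ∕ y) (^-*-assoc (suc j) (suc j) Λ) (^-*-assoc j (suc j) Λ)
        (≼-^ (lower≼upper T j) Λ))

  [1+1/T]^Λ≼2^ω : suc T ^ Λ ∕ T ^ Λ ≼ 2 ^ ω ∕ 1 ^ ω
  [1+1/T]^Λ≼2^ω = subst₂ (λ x y → x ∕ y ≼ 2 ^ ω ∕ 1 ^ ω) (^-*-assoc (suc T) q ω) (^-*-assoc T q ω)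
    (≼-^ ([1+1/2q]^q≼2 q) ω)

  -- (1 + 1/k)ⁿ ≤ ((1 + 1/T)ᵀ⁺¹)^μ, while 2^d is at most (1 + 1/T)^(Td). Since μ + d = Λ, the
  -- product is at most (1 + 1/T)^(TΛ) times (1 + 1/T)^μ, hence at most 8nC · 2^ω, and n ≤ (k + 1)Λ
  -- extracts the factor k + 1. It is applied with d = 0 and with d = 4ω.
  decay : ∀ k μ d → T ≤ k → n ≤ suc k * μ → μ + d ≡ Λ → 2 ^ d * suc k ^ n ≤ 4 ^ ω * suc k * k ^ n
  decay k μ d T≤k n≤ μ+d≡Λ = begin
    2 ^ d * suc k ^ n                        ≡⟨ *-identityʳ _ ⟨
    2 ^ d * suc k ^ n * 1                    ≡⟨ cong (2 ^ d * suc k ^ n *_) (trans (*-identityˡ (1 ^ ω)) (^-zeroˡ ω)) ⟨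
    2 ^ d * suc k ^ n * (1 * 1 ^ ω)          ≤⟨ cross (≼-trans _ _ {{den≢0}} step₁ step₂) ⟩
    8 * n * C * 2 ^ ω * (1 ^ d * k ^ n)      ≡⟨ cong (λ t → 8 * n * C * 2 ^ ω * (t * k ^ n)) (^-zeroˡ d) ⟩
    8 * n * C * 2 ^ ω * (1 * k ^ n)          ≤⟨ *-monoˡ-≤ (1 * k ^ n) (*-monoˡ-≤ (2 ^ ω) (*-monoˡ-≤ C (*-monoʳ-≤ 8 n≤Λ))) ⟩
    8 * (suc k * Λ) * C * 2 ^ ω * (1 * k ^ n)  ≡⟨ eq₁ (suc k) Λ C (2 ^ ω) (k ^ n) ⟩
    8 * C * Λ * (2 ^ ω * (suc k * k ^ n))    ≤⟨ *-monoˡ-≤ _ 8CΛ≤2^ω ⟩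
    2 ^ ω * (2 ^ ω * (suc k * k ^ n))        ≡⟨ eq₂ (2 ^ ω) (suc k) (k ^ n) ⟩
    2 ^ ω * 2 ^ ω * suc k * k ^ n            ≡⟨ cong (λ t → t * suc k * k ^ n) (^-distribʳ-* ω 2 2) ⟨
    4 ^ ω * suc k * k ^ n                    ∎
    where
    eq₁ : ∀ s l c p x → 8 * (s * l) * c * p * (1 * x) ≡ 8 * c * l * (p * (s * x))
    eq₁ = solve-∀
    eq₂ : ∀ p s x → p * (p * (s * x)) ≡ p * p * s * x
    eq₂ = solve-∀
    eq₃ : ∀ t d m → t * d + suc t * m ≡ t * (m + d) + m
    eq₃ = solve-∀
    μ≤Λ : μ ≤ Λ
    μ≤Λ = ≤-trans (m≤m+n μ d) (≤-reflexive μ+d≡Λ)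
    n≤Λ : n ≤ suc k * Λ
    n≤Λ = ≤-trans n≤ (*-monoʳ-≤ (suc k) μ≤Λ)
    instance
      k≢0 : NonZero k
      k≢0 = >-nonZero (≤-trans (>-nonZero⁻¹ T) T≤k)
    exponents : ∀ x → (x ^ T) ^ d * (x ^ suc T) ^ μ ≡ x ^ (T * Λ) * x ^ μ
    exponents x = begin-equality
      (x ^ T) ^ d * (x ^ suc T) ^ μ    ≡⟨ cong₂ _*_ (^-*-assoc x T d) (^-*-assoc x (suc T) μ) ⟩
      x ^ (T * d) * x ^ (suc T * μ)    ≡⟨ ^-distribˡ-+-* x (T * d) (suc T * μ) ⟨
      x ^ (T * d + suc T * μ)          ≡⟨ cong (x ^_) (trans (eq₃ T d μ) (cong (λ t → T * t + μ) μ+d≡Λ)) ⟩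
      x ^ (T * Λ + μ)                  ≡⟨ ^-distribˡ-+-* x (T * Λ) μ ⟩
      x ^ (T * Λ) * x ^ μ              ∎
    den≢0 : NonZero (T ^ (T * Λ) * T ^ μ)
    den≢0 = m*n≢0 _ _ {{m^n≢0 T (T * Λ)}} {{m^n≢0 T μ}}
    step₀ : suc k ^ n ∕ k ^ n ≼ (suc T ^ suc T) ^ μ ∕ (T ^ suc T) ^ μ
    step₀ = ≼-trans ((suc k ^ suc k) ^ μ) ((k ^ suc k) ^ μ) {{m^n≢0 _ μ {{m^n≢0 k (suc k)}}}}
      (subst₂ (λ x y → suc k ^ n ∕ k ^ n ≼ x ∕ y) (sym (^-*-assoc (suc k) (suc k) μ)) (sym (^-*-assoc k (suc k) μ))
        (≼-^-exp (n≤1+n k) n≤))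
      (≼-^ (upper-antitone T≤k) μ)
    step₁ : 2 ^ d * suc k ^ n ∕ 1 ^ d * k ^ n ≼ suc T ^ (T * Λ) * suc T ^ μ ∕ T ^ (T * Λ) * T ^ μ
    step₁ = subst₂ (λ x y → 2 ^ d * suc k ^ n ∕ 1 ^ d * k ^ n ≼ x ∕ y) (exponents (suc T)) (exponents T)
      (≼-* (≼-^ (2≼lower T) d) step₀)
    step₂ : suc T ^ (T * Λ) * suc T ^ μ ∕ T ^ (T * Λ) * T ^ μ ≼ 8 * n * C * 2 ^ ω ∕ 1 * 1 ^ ω
    step₂ = ≼-* ≼8nC (≼-trans (suc T ^ Λ) (T ^ Λ) {{m^n≢0 T Λ}} (≼-^-exp (n≤1+n T) μ≤Λ) [1+1/T]^Λ≼2^ω)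

-- Comparison of D(n,k) with D(n,k₀)

-- Twice the error of the union bound is 2(j + 1)(jⁿ + n jⁿ⁻¹), at most 6n jⁿ because j + 1 ≤ n and
-- j + 1 ≤ 2j; the 8 of the hypothesis leaves room for this.
pow≤2W : ∀ j n .{{_ : NonZero j}} → suc j ≤ n → 8 * n * j ^ n ≤ suc j ^ n → suc j ^ n ≤ 2 * W (suc j) n
pow≤2W j n j<n small = +-cancelʳ-≤ (suc j ^ n) _ _ (begin
  X + X                                                ≤⟨ +-mono-≤ (pow≤W+ (suc j) n) (pow≤W+ (suc j) n) ⟩
  (w + suc j * bad) + (w + suc j * bad)                ≡⟨ eq₁ w (suc j * bad) ⟩
  2 * w + 2 * (suc j * bad)                            ≤⟨ +-monoʳ-≤ (2 * w) bad≤ ⟩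
  2 * w + X ∎)
  where
  open ≤-Reasoning
  X = suc j ^ n
  w = W (suc j) n
  bad = j ^ n + dpow j n
  eq₁ : ∀ w b → (w + b) + (w + b) ≡ 2 * w + 2 * b
  eq₁ = solve-∀
  eq₂ : ∀ s x y → 2 * (s * (x + y)) ≡ 2 * s * x + 2 * (s * y)
  eq₂ = solve-∀
  eq₃ : ∀ n x → 2 * n * x + 2 * (2 * (n * x)) ≡ 6 * n * x
  eq₃ = solve-∀
  sj≤2j : ∀ j .{{_ : NonZero j}} → suc j ≤ 2 * j
  sj≤2j (suc j) = ≤-trans (m≤n+m (2 + j) j) (≤-reflexive (eq j))
    where
    eq : ∀ j → j + (2 + j) ≡ 2 * (1 + j)
    eq = solve-∀
  bad≤ : 2 * (suc j * bad) ≤ X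
  bad≤ = begin
    2 * (suc j * (j ^ n + dpow j n))                ≡⟨ eq₂ (suc j) (j ^ n) (dpow j n) ⟩
    2 * suc j * j ^ n + 2 * (suc j * dpow j n)      ≤⟨ +-mono-≤ (*-monoˡ-≤ (j ^ n) (*-monoʳ-≤ 2 j<n)) (*-monoʳ-≤ 2 (*-monoˡ-≤ (dpow j n) (sj≤2j j))) ⟩
    2 * n * j ^ n + 2 * (2 * j * dpow j n)          ≡⟨ cong (λ t → 2 * n * j ^ n + 2 * t) (trans (*-assoc 2 j _) (cong (2 *_) (*-dpow j n))) ⟩
    2 * n * j ^ n + 2 * (2 * (n * j ^ n))           ≡⟨ eq₃ n (j ^ n) ⟩
    6 * n * j ^ n                                   ≤⟨ *-monoˡ-≤ (j ^ n) (*-monoˡ-≤ n (m≤m+n 6 2)) ⟩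
    8 * n * j ^ n                                   ≤⟨ small ⟩
    X ∎

-- Half of the factor 4 pays for the lower bound on W k₀ n. The other half gives 2 D(n,k) ≤ D(n,k₀),
-- which is strict because D(n,k₀) is positive.
D-< : ∀ n k k₀ .{{_ : NonZero k₀}} → k₀ ^ n ≤ 2 * W k₀ n → 4 * (k ^ n * k₀ !) ≤ k₀ ^ n * k ! → D n k < D n k₀
D-< n k k₀ many few = double-< (D n k) (D n k₀) D₀>0
  (*-cancelˡ-≤ (2 * (k ! * k₀ !)) {{m*n≢0 2 (k ! * k₀ !) {{_}} {{m*n≢0 (k !) (k₀ !) {{k !≢0}} {{k₀ !≢0}}}}}} (begin
    2 * (k ! * k₀ !) * (2 * D n k)   ≡⟨ eq₁ (k !) (k₀ !) (D n k) ⟩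
    4 * (k ! * D n k * k₀ !)         ≡⟨ cong (λ t → 4 * (t * k₀ !)) (!*D≡W n k) ⟩
    4 * (W k n * k₀ !)               ≤⟨ *-monoʳ-≤ 4 (*-monoˡ-≤ (k₀ !) (W≤pow k n)) ⟩
    4 * (k ^ n * k₀ !)               ≤⟨ few ⟩
    k₀ ^ n * k !                     ≤⟨ *-monoˡ-≤ (k !) many ⟩
    2 * W k₀ n * k !                 ≡⟨ cong (λ t → 2 * t * k !) (!*D≡W n k₀) ⟨
    2 * (k₀ ! * D n k₀) * k !        ≡⟨ eq₂ (k !) (k₀ !) (D n k₀) ⟩
    2 * (k ! * k₀ !) * D n k₀        ∎))
  where
  open ≤-Reasoning
  eq₁ : ∀ x y d → 2 * (x * y) * (2 * d) ≡ 4 * (x * d * y)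
  eq₁ = solve-∀
  eq₂ : ∀ x y d → 2 * (y * d) * x ≡ 2 * (x * y) * d
  eq₂ = solve-∀
  double-< : ∀ x y → 0 < y → 2 * x ≤ y → x < y
  double-< zero    y 0<y _ = 0<y
  double-< (suc x) y _   h = ≤-trans (s≤s (≤-trans (m≤m+n (suc x) 0) (m≤n+m _ x))) h
  D₀>0 : 0 < D n k₀
  D₀>0 with D n k₀ in eq
  ... | suc _ = s≤s z≤n
  ... | zero  = begin
    1                       ≤⟨ m^n>0 k₀ n ⟩
    k₀ ^ n                  ≤⟨ many ⟩
    2 * W k₀ n              ≡⟨ cong (2 *_) (!*D≡W n k₀) ⟨
    2 * (k₀ ! * D n k₀)     ≡⟨ cong (λ t → 2 * (k₀ ! * t)) eq ⟩
    2 * (k₀ ! * 0)          ≡⟨ cong (2 *_) (*-zeroʳ (k₀ !)) ⟩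
    0 ∎

module _ (n : ℕ) where
  open ≤-Reasoning

  rise-chain : ∀ r k₀ → (∀ k → k₀ ≤ k → suc k ^ n ≤ r * suc k * k ^ n) →
               ∀ a → (k₀ + a) ^ n * k₀ ! ≤ r ^ a * (k₀ ^ n * (k₀ + a) !)
  rise-chain r k₀ rise zero rewrite +-identityʳ k₀ = m≤m+n _ 0
  rise-chain r k₀ rise (suc a) rewrite +-suc k₀ a = begin
    suc k ^ n * k₀ !                              ≤⟨ *-monoˡ-≤ (k₀ !) (rise k (m≤m+n k₀ a)) ⟩
    r * suc k * k ^ n * k₀ !                      ≡⟨ *-assoc (r * suc k) (k ^ n) (k₀ !) ⟩
    r * suc k * (k ^ n * k₀ !)                    ≤⟨ *-monoʳ-≤ (r * suc k) (rise-chain r k₀ rise a) ⟩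
    r * suc k * (r ^ a * (k₀ ^ n * k !))          ≡⟨ eq r (suc k) (r ^ a) (k₀ ^ n) (k !) ⟩
    r * r ^ a * (k₀ ^ n * (suc k * k !))          ∎
    where
    k = k₀ + a
    eq : ∀ r s x y z → r * s * (x * (y * z)) ≡ r * x * (y * (s * z))
    eq = solve-∀

  drop-chain : ∀ r k₂ → (∀ k → k₂ ≤ k → r * suc k ^ n ≤ suc k * k ^ n) →
               ∀ b → r ^ b * ((k₂ + b) ^ n * k₂ !) ≤ k₂ ^ n * (k₂ + b) !
  drop-chain r k₂ drop zero rewrite +-identityʳ k₂ = ≤-reflexive (+-identityʳ _)
  drop-chain r k₂ drop (suc b) rewrite +-suc k₂ b = begin
    r * r ^ b * (suc k ^ n * k₂ !)          ≡⟨ eq₁ r (r ^ b) (suc k ^ n) (k₂ !) ⟩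
    r * suc k ^ n * (r ^ b * k₂ !)          ≤⟨ *-monoˡ-≤ _ (drop k (m≤m+n k₂ b)) ⟩
    suc k * k ^ n * (r ^ b * k₂ !)          ≡⟨ eq₂ (suc k) (k ^ n) (r ^ b) (k₂ !) ⟩
    suc k * (r ^ b * (k ^ n * k₂ !))        ≤⟨ *-monoʳ-≤ (suc k) (drop-chain r k₂ drop b) ⟩
    suc k * (k₂ ^ n * k !)                  ≡⟨ eq₃ (suc k) (k₂ ^ n) (k !) ⟩
    k₂ ^ n * (suc k * k !)                  ∎
    where
    k = k₂ + b
    eq₁ : ∀ r x y z → r * x * (y * z) ≡ r * y * (x * z)
    eq₁ = solve-∀
    eq₂ : ∀ s x y z → s * x * (y * z) ≡ s * (y * (x * z))
    eq₂ = solve-∀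
    eq₃ : ∀ s x y → s * (x * y) ≡ x * (s * y)
    eq₃ = solve-∀

  -- Over a steps kⁿ/k! grows at most by the factor rᵃ, and over the next b > a steps it shrinks by rᵇ.
  rise-drop : ∀ r k₀ a b .{{_ : NonZero r}} → a < b →
    (∀ k → k₀ ≤ k → suc k ^ n ≤ r * suc k * k ^ n) →
    (∀ k → k₀ + a ≤ k → r * suc k ^ n ≤ suc k * k ^ n) →
    r * ((k₀ + a + b) ^ n * k₀ !) ≤ k₀ ^ n * (k₀ + a + b) !
  rise-drop r k₀ a b a<b rise drop = *-cancelˡ-≤ (r ^ a * k₂ !) {{m*n≢0 _ _ {{m^n≢0 r a}} {{k₂ !≢0}}}} (begin
    r ^ a * k₂ ! * (r * (k ^ n * k₀ !))    ≡⟨ eq₁ (r ^ a) r (k₂ !) (k ^ n) (k₀ !) ⟩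
    r ^ suc a * (k ^ n * k₂ !) * k₀ !      ≤⟨ *-monoˡ-≤ (k₀ !) (*-monoˡ-≤ (k ^ n * k₂ !) (^-monoʳ-≤ r a<b)) ⟩
    r ^ b * (k ^ n * k₂ !) * k₀ !          ≤⟨ *-monoˡ-≤ (k₀ !) (drop-chain r k₂ drop b) ⟩
    k₂ ^ n * k ! * k₀ !                    ≡⟨ eq₂ (k₂ ^ n) (k !) (k₀ !) ⟩
    k₂ ^ n * k₀ ! * k !                    ≤⟨ *-monoˡ-≤ (k !) (rise-chain r k₀ rise a) ⟩
    r ^ a * (k₀ ^ n * k₂ !) * k !          ≡⟨ eq₃ (r ^ a) (k₀ ^ n) (k₂ !) (k !) ⟩
    r ^ a * k₂ ! * (k₀ ^ n * k !)          ∎)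
    where
    k₂ = k₀ + a
    k  = k₀ + a + b
    eq₁ : ∀ x r y z w → x * y * (r * (z * w)) ≡ r * x * (z * y) * w
    eq₁ = solve-∀
    eq₂ : ∀ x y z → x * y * z ≡ x * z * y
    eq₂ = solve-∀
    eq₃ : ∀ x y z w → x * (y * z) * w ≡ x * z * (y * w)
    eq₃ = solve-∀

  -- The factor 4 is kept from the first step only; on later steps g need merely not decrease.
  rise-before : ∀ k₀ → (∀ j .{{_ : NonZero j}} → suc j ≤ k₀ → 4 * suc j * j ^ n ≤ suc j ^ n) →
                ∀ j .{{_ : NonZero j}} → j < k₀ → 4 * (j ^ n * k₀ !) ≤ k₀ ^ n * j !
  rise-before k₀ rise j j<k₀ = go (≤⇒≤′ j<k₀) ≤-refl
    where
    go : ∀ {k} → suc j ≤′ k → k ≤ k₀ → 4 * (j ^ n * k !) ≤ k ^ n * j !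
    go ≤′-refl k≤k₀ = begin
      4 * (j ^ n * (suc j * j !))   ≡⟨ eq (j ^ n) (suc j) (j !) ⟩
      4 * suc j * j ^ n * j !       ≤⟨ *-monoˡ-≤ (j !) (rise j k≤k₀) ⟩
      suc j ^ n * j !               ∎
      where
      eq : ∀ x s y → 4 * (x * (s * y)) ≡ 4 * s * x * y
      eq = solve-∀
    go {suc k} (≤′-step j<k) k<k₀ = begin
      4 * (j ^ n * (suc k * k !))   ≡⟨ eq₁ (j ^ n) (suc k) (k !) ⟩
      suc k * (4 * (j ^ n * k !))   ≤⟨ *-monoʳ-≤ (suc k) (go j<k (<⇒≤ k<k₀)) ⟩
      suc k * (k ^ n * j !)         ≤⟨ m≤n*m _ 4 ⟩
      4 * (suc k * (k ^ n * j !))   ≡⟨ eq₂ (suc k) (k ^ n) (j !) ⟩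
      4 * suc k * k ^ n * j !       ≤⟨ *-monoˡ-≤ (j !) (rise k {{>-nonZero (≤-trans (s≤s z≤n) (≤′⇒≤ j<k))}} k<k₀) ⟩
      suc k ^ n * j !               ∎
      where
      eq₁ : ∀ x s y → 4 * (x * (s * y)) ≡ s * (4 * (x * y))
      eq₁ = solve-∀
      eq₂ : ∀ s x y → 4 * (s * (x * y)) ≡ 4 * s * x * y
      eq₂ = solve-∀

-- Location of the peaks

module Location (n p q ω C : ℕ) .{{q≢0 : NonZero q}} .{{ω≢0 : NonZero ω}} (q≡ : q ≡ 4 * (2 + p))
  (8n≼ : 8 * n ∕ 1 ≼ suc (q + q) ^ ((q + q) * (q * ω)) ∕ (q + q) ^ ((q + q) * (q * ω)))
  (≼8nC : suc (q + q) ^ ((q + q) * (q * ω)) ∕ (q + q) ^ ((q + q) * (q * ω)) ≼ 8 * n * C ∕ 1)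
  (8CΛ≤2^ω : 8 * C * (q * ω) ≤ 2 ^ ω)
  (k₀ a : ℕ) (k₀Λ≤n : k₀ * (q * ω) ≤ n) (n≤k₀Λ : n ≤ suc k₀ * (q * ω)) (T≤k₀ : q + q ≤ k₀)
  (n≤k₂ : n ≤ suc (k₀ + a) * (4 * (1 + p) * ω))
  where

  open Ratio n q ω C 8n≼ ≼8nC 8CΛ≤2^ω
  open ≤-Reasoning

  Λ≢0 : NonZero Λ
  Λ≢0 = m*n≢0 q ω

  2≤k₀ : 2 ≤ k₀
  2≤k₀ = ≤-trans (+-mono-≤ (>-nonZero⁻¹ q) (>-nonZero⁻¹ q)) T≤k₀

  k₀≤n : k₀ ≤ n
  k₀≤n = ≤-trans (m≤m*n k₀ Λ {{Λ≢0}}) k₀Λ≤n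

  many : k₀ ^ n ≤ 2 * W k₀ n
  many = go k₀ k₀Λ≤n k₀≤n 2≤k₀
    where
    go : ∀ k → k * Λ ≤ n → k ≤ n → 2 ≤ k → k ^ n ≤ 2 * W k n
    go 1 _ _ (s≤s ())
    -- `growth` and `pow≤2W` speak about a nonzero predecessor j of k₀, hence 2 ≤ k₀.
    go (suc j@(suc _)) Λ≤n j<n _ = pow≤2W j n j<n (growth j Λ≤n)

  instance
    k₀≢0 : NonZero k₀
    k₀≢0 = >-nonZero (≤-trans (s≤s z≤n) 2≤k₀)

  D-below : ∀ j .{{_ : NonZero j}} → j < k₀ → D n j < D n k₀
  D-below j j<k₀ = D-< n j k₀ many (rise-before n k₀ rise j j<k₀)
    where
    rise : ∀ j .{{_ : NonZero j}} → suc j ≤ k₀ → 4 * suc j * j ^ n ≤ suc j ^ n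
    rise j j<k₀ = ≤-trans (*-monoˡ-≤ (j ^ n) (*-mono-≤ {4} {8} (m≤m+n 4 4) (≤-trans j<k₀ k₀≤n)))
      (growth j (≤-trans (*-monoˡ-≤ Λ j<k₀) k₀Λ≤n))

  r : ℕ
  r = 4 ^ ω

  r≢0 : NonZero r
  r≢0 = m^n≢0 4 ω

  4≤r : 4 ≤ r
  4≤r = ^-monoʳ-≤ 4 {1} {ω} (>-nonZero⁻¹ ω)

  D-above : ∀ b → a < b → D n (k₀ + a + b) < D n k₀
  D-above b a<b = D-< n (k₀ + a + b) k₀ many
    (≤-trans (*-monoˡ-≤ _ 4≤r) (rise-drop n r k₀ a b {{r≢0}} a<b rise drop))
    where
    rise : ∀ k → k₀ ≤ k → suc k ^ n ≤ r * suc k * k ^ n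
    rise k k₀≤k = subst (_≤ r * suc k * k ^ n) (*-identityˡ _)
      (decay k Λ 0 (≤-trans T≤k₀ k₀≤k) (≤-trans n≤k₀Λ (*-monoˡ-≤ Λ (s≤s k₀≤k))) (+-identityʳ Λ))
    μ+d : ∀ p ω → 4 * (1 + p) * ω + 4 * ω ≡ 4 * (2 + p) * ω
    μ+d = solve-∀
    -- One factor r cancels the loss in `decay`; the other is the drop required of each step.
    rr : 2 ^ (4 * ω) ≡ r * r
    rr = trans (sym (^-*-assoc 2 4 ω)) (^-distribʳ-* ω 4 4)
    drop : ∀ k → k₀ + a ≤ k → r * suc k ^ n ≤ suc k * k ^ n
    drop k k₂≤k = *-cancelˡ-≤ r {{r≢0}} (begin
      r * (r * suc k ^ n)        ≡⟨ *-assoc r r _ ⟨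
      r * r * suc k ^ n          ≡⟨ cong (_* suc k ^ n) rr ⟨
      2 ^ (4 * ω) * suc k ^ n    ≤⟨ decay k _ (4 * ω) (≤-trans T≤k₀ (≤-trans (m≤m+n k₀ a) k₂≤k))
                                      (≤-trans n≤k₂ (*-monoˡ-≤ _ (s≤s k₂≤k))) (trans (μ+d p ω) (cong (_* ω) (sym q≡))) ⟩
      r * suc k * k ^ n          ≡⟨ *-assoc r (suc k) _ ⟩
      r * (suc k * k ^ n)        ∎)

  peak-≥ : ∀ {K} → IsPeak n K → k₀ ≤ K
  peak-≥ {K} peak = ≮⇒≥ λ K<k₀ → <-irrefl refl (<-≤-trans
    (D-below K {{>-nonZero (IsPeak.1≤k peak)}} K<k₀)
    (IsPeak.maximal peak k₀ (>-nonZero⁻¹ k₀) k₀≤n))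

  peak-≤ : ∀ {K} → IsPeak n K → K ≤ k₀ + a + a
  peak-≤ {K} peak = ≮⇒≥ λ K> → beyond (m≤n⇒∃[o]m+o≡n K>)
    where
    eq : ∀ x a o → suc (x + a + o) ≡ x + (suc a + o)
    eq = solve-∀
    beyond : ¬ (∃[ o ] suc (k₀ + a + a) + o ≡ K)
    beyond (o , refl) = <-irrefl refl (<-≤-trans
      (D-above (suc a + o) (s≤s (m≤m+n a o)))
      (subst (λ t → D n k₀ ≤ D n t) (eq (k₀ + a) a o)
        (IsPeak.maximal peak k₀ (>-nonZero⁻¹ k₀) k₀≤n)))

-- Bounds for the Riemann sums of log n

open import Data.Integer.Base using (+_)

m<[1+m/n]*n : ∀ m n .{{_ : NonZero n}} → m < suc (m ℕ./ n) * n
m<[1+m/n]*n m n = begin-strict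
  m                        ≡⟨ m≡m%n+[m/n]*n m n ⟩
  m ℕ.% n + m ℕ./ n * n    <⟨ +-monoˡ-< (m ℕ./ n * n) (m%n<n m n) ⟩
  n + m ℕ./ n * n          ∎
  where open ≤-Reasoning

/-mono : ∀ a b c d .{{_ : NonZero b}} .{{_ : NonZero d}} → a * d ≤ c * b → + a / b ℚ.≤ + c / d
/-mono a (suc b) c (suc d) h = ℚ.toℚᵘ-cancel-≤ (begin
  ℚ.toℚᵘ (+ a / suc b)  ≃⟨ ℚ.toℚᵘ-fromℚᵘ (mkℚᵘ (+ a) b) ⟩
  mkℚᵘ (+ a) b          ≤⟨ ℚᵘ.*≤* (subst₂ ℤ._≤_ (ℤ.pos-* a (suc d)) (ℤ.pos-* c (suc b)) (ℤ.+≤+ h)) ⟩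
  mkℚᵘ (+ c) d          ≃⟨ ℚ.toℚᵘ-fromℚᵘ (mkℚᵘ (+ c) d) ⟨
  ℚ.toℚᵘ (+ c / suc d)  ∎)
  where open ℚᵘ.≤-Reasoning

/-cong′ : ∀ a b c d .{{_ : NonZero b}} .{{_ : NonZero d}} → a * d ≡ c * b → + a / b ≡ + c / d
/-cong′ a b c d eq = ℚ.≤-antisym (/-mono a b c d (≤-reflexive eq)) (/-mono c d a b (≤-reflexive (sym eq)))

/-+ : ∀ a b d .{{_ : NonZero d}} → + (a + b) / d ≡ + a / d ℚ.+ + b / d
/-+ a b (suc d) = ℚ.toℚᵘ-injective (begin-equality
  ℚ.toℚᵘ (+ (a + b) / suc d)                       ≃⟨ ℚ.toℚᵘ-fromℚᵘ (mkℚᵘ (+ (a + b)) d) ⟩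
  mkℚᵘ (+ (a + b)) d                               ≃⟨ ℚᵘ.*≡* eq ⟩
  mkℚᵘ (+ a) d ℚᵘ.+ mkℚᵘ (+ b) d                   ≃⟨ ℚᵘ.+-cong (ℚ.toℚᵘ-fromℚᵘ (mkℚᵘ (+ a) d)) (ℚ.toℚᵘ-fromℚᵘ (mkℚᵘ (+ b) d)) ⟨
  ℚ.toℚᵘ (+ a / suc d) ℚᵘ.+ ℚ.toℚᵘ (+ b / suc d)   ≃⟨ ℚ.toℚᵘ-homo-+ (+ a / suc d) (+ b / suc d) ⟨
  ℚ.toℚᵘ (+ a / suc d ℚ.+ + b / suc d)             ∎)
  where
  open ℚᵘ.≤-Reasoning
  s = + suc d
  eq : + (a + b) ℤ.* (s ℤ.* s) ≡ (+ a ℤ.* s ℤ.+ + b ℤ.* s) ℤ.* s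
  eq = trans (sym (ℤ.*-assoc (+ (a + b)) s s)) (cong (ℤ._* s) (ℤ.*-distribʳ-+ s (+ a) (+ b)))

/-* : ∀ a b c d .{{_ : NonZero b}} .{{_ : NonZero d}} .{{_ : NonZero (b * d)}} →
      (+ a / b) ℚ.* (+ c / d) ≡ + (a * c) / (b * d)
/-* a (suc b) c (suc d) = ℚ.toℚᵘ-injective (begin-equality
  ℚ.toℚᵘ ((+ a / suc b) ℚ.* (+ c / suc d))         ≃⟨ ℚ.toℚᵘ-homo-* (+ a / suc b) (+ c / suc d) ⟩
  ℚ.toℚᵘ (+ a / suc b) ℚᵘ.* ℚ.toℚᵘ (+ c / suc d)   ≃⟨ ℚᵘ.*-cong (ℚ.toℚᵘ-fromℚᵘ (mkℚᵘ (+ a) b)) (ℚ.toℚᵘ-fromℚᵘ (mkℚᵘ (+ c) d)) ⟩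
  mkℚᵘ (+ a) b ℚᵘ.* mkℚᵘ (+ c) d                   ≃⟨ ℚᵘ.*≡* (cong (ℤ._* (+ (suc b * suc d))) (sym (ℤ.pos-* a c))) ⟩
  mkℚᵘ (+ (a * c)) (d + b * suc d)                 ≃⟨ ℚ.toℚᵘ-fromℚᵘ (mkℚᵘ (+ (a * c)) (d + b * suc d)) ⟨
  ℚ.toℚᵘ (+ (a * c) / (suc b * suc d))             ∎)
  where open ℚᵘ.≤-Reasoning

recipSum-upper : ∀ a l → recipSum a l ℚ.≤ + l / suc a
recipSum-upper a zero    = /-mono 0 1 0 (suc a) z≤n
recipSum-upper a (suc l) = begin
  recipSum a l ℚ.+ + 1 / suc (a + l)  ≤⟨ ℚ.+-mono-≤ (recipSum-upper a l)
                                           (/-mono 1 (suc (a + l)) 1 (suc a) (*-monoʳ-≤ 1 (s≤s (m≤m+n a l)))) ⟩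
  + l / suc a ℚ.+ + 1 / suc a         ≡⟨ /-+ l 1 (suc a) ⟨
  + (l + 1) / suc a                   ≡⟨ cong (λ x → + x / suc a) (+-comm l 1) ⟩
  + suc l / suc a                     ∎
  where open ℚ.≤-Reasoning

recipSum-lower : ∀ a l b .{{_ : NonZero b}} → a + l ≤ b → + l / b ℚ.≤ recipSum a l
recipSum-lower a zero    b h = /-mono 0 b 0 1 z≤n
recipSum-lower a (suc l) b h = begin
  + suc l / b                         ≡⟨ cong (λ x → + x / b) (+-comm l 1) ⟨
  + (l + 1) / b                       ≡⟨ /-+ l 1 b ⟩
  + l / b ℚ.+ + 1 / b                 ≤⟨ ℚ.+-mono-≤ (recipSum-lower a l b (≤-trans (+-monoʳ-≤ a (n≤1+n l)) h))
                                           (/-mono 1 b 1 (suc (a + l)) (*-monoʳ-≤ 1 (subst (_≤ b) (+-suc a l) h))) ⟩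
  recipSum a l ℚ.+ + 1 / suc (a + l)  ∎
  where open ℚ.≤-Reasoning

recipSum-split : ∀ a l r → recipSum a (l + r) ≡ recipSum a l ℚ.+ recipSum (a + l) r
recipSum-split a l zero    = trans (cong (recipSum a) (+-identityʳ l)) (sym (ℚ.+-identityʳ _))
recipSum-split a l (suc r) = begin
  recipSum a (l + suc r)                                            ≡⟨ cong (recipSum a) (+-suc l r) ⟩
  recipSum a (l + r) ℚ.+ + 1 / suc (a + (l + r))                    ≡⟨ cong₂ ℚ._+_ (recipSum-split a l r) (cong (λ x → + 1 / suc x) (sym (+-assoc a l r))) ⟩
  recipSum a l ℚ.+ recipSum (a + l) r ℚ.+ + 1 / suc (a + l + r)     ≡⟨ ℚ.+-assoc (recipSum a l) (recipSum (a + l) r) _ ⟩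
  recipSum a l ℚ.+ (recipSum (a + l) r ℚ.+ + 1 / suc (a + l + r))   ∎
  where open ≡-Reasoning

recipSum-mono : ∀ a {l m} → l ≤ m → recipSum a l ℚ.≤ recipSum a m
recipSum-mono a {l} l≤m with m≤n⇒∃[o]m+o≡n l≤m
... | r , refl = begin
  recipSum a l                          ≡⟨ ℚ.+-identityʳ _ ⟨
  recipSum a l ℚ.+ 0ℚ                   ≤⟨ ℚ.+-monoʳ-≤ (recipSum a l)
                                             (ℚ.≤-trans (/-mono 0 1 r (suc (a + l + r)) z≤n)
                                               (recipSum-lower (a + l) r (suc (a + l + r)) (n≤1+n _))) ⟩
  recipSum a l ℚ.+ recipSum (a + l) r   ≡⟨ recipSum-split a l r ⟨
  recipSum a (l + r)                    ∎
  where open ℚ.≤-Reasoning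

-- One block multiplies the endpoint a by about 1 + 1/T and adds about 1/T to the sum. For a ≥ T²
-- the quotient of a by T is at least T, so rounding changes 1/T by no more than to 1/(T - 1) or
-- 1/(T + 2).
module Blocks (T : ℕ) .{{T≢0 : NonZero T}} .{{T-1≢0 : NonZero (pred T)}} where

  T≤a/T : ∀ a → T * T ≤ a → T ≤ a ℕ./ T
  T≤a/T a h = ≤-trans (≤-reflexive (sym (m*n/n≡m T T))) (/-mono-≤ h (≤-refl {T}))

  block-upper : ∀ a → T * T ≤ a → recipSum a (suc (a ℕ./ T)) ℚ.≤ + 1 / pred T
  block-upper a T²≤a = ℚ.≤-trans (recipSum-upper a l) (/-mono l (suc a) 1 (pred T) (begin
    l * pred T  ≤⟨ +-cancelʳ-≤ l _ _ (begin
                     l * pred T + l     ≡⟨ eq l (pred T) ⟩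
                     l * suc (pred T)   ≡⟨ cong (l *_) (suc-pred T) ⟩
                     T + a ℕ./ T * T    ≤⟨ +-mono-≤ (T≤a/T a T²≤a) (m/n*n≤m a T) ⟩
                     a ℕ./ T + a        ≡⟨ +-comm _ a ⟩
                     a + a ℕ./ T        ≤⟨ +-monoʳ-≤ a (n≤1+n _) ⟩
                     a + l              ∎) ⟩
    a           ≤⟨ n≤1+n a ⟩
    suc a       ≡⟨ *-identityˡ (suc a) ⟨
    1 * suc a   ∎))
    where
    open ≤-Reasoning
    l = suc (a ℕ./ T)
    eq : ∀ l t → l * t + l ≡ l * (1 + t)
    eq = solve-∀

  block-lower : ∀ a → T * T ≤ a → + 1 / (2 + T) ℚ.≤ recipSum a (a ℕ./ T)
  block-lower a T²≤a = ℚ.≤-trans (/-mono 1 (2 + T) l (a + l) {{_}} {{a+l≢0}} (begin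
    1 * (a + l)         ≡⟨ *-identityˡ _ ⟩
    a + l               ≤⟨ +-monoˡ-≤ l (<⇒≤ (m<[1+m/n]*n a T)) ⟩
    T + l * T + l       ≤⟨ +-monoˡ-≤ l (+-monoˡ-≤ (l * T) (T≤a/T a T²≤a)) ⟩
    l + l * T + l       ≡⟨ eq l T ⟩
    l * (2 + T)         ∎))
    (recipSum-lower a l (a + l) {{a+l≢0}} ≤-refl)
    where
    open ≤-Reasoning
    l = a ℕ./ T
    eq : ∀ l t → l + l * t + l ≡ l * (2 + t)
    eq = solve-∀
    a+l≢0 : NonZero (a + l)
    a+l≢0 = >-nonZero (≤-trans (>-nonZero⁻¹ (T * T) {{m*n≢0 T T}}) (≤-trans T²≤a (m≤m+n a l)))

  module _ (M : ℕ) (T²≤M : T * T ≤ M) where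

    -- Rounding block lengths up makes the endpoint overshoot (1 + 1/T)ⁱM; `blocks-lower` rounds
    -- down to stay below it.
    blocks-upper : ∀ i → ∃[ l ] (suc T ^ i * M ≤ T ^ i * (M + l) × recipSum M l ℚ.≤ + i / pred T)
    blocks-upper zero    = 0 , *-monoʳ-≤ 1 (m≤m+n M 0) , /-mono 0 1 0 (pred T) z≤n
    blocks-upper (suc i) with blocks-upper i
    ... | l , far , small = l + r , (begin
      suc T * suc T ^ i * M        ≡⟨ *-assoc (suc T) (suc T ^ i) M ⟩
      suc T * (suc T ^ i * M)      ≤⟨ *-monoʳ-≤ (suc T) far ⟩
      suc T * (T ^ i * a)          ≡⟨ eq₁ T (T ^ i) a ⟩
      T ^ i * (a + T * a)          ≤⟨ *-monoʳ-≤ (T ^ i) (+-monoˡ-≤ (T * a) (<⇒≤ (m<[1+m/n]*n a T))) ⟩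
      T ^ i * (r * T + T * a)      ≡⟨ eq₂ T (T ^ i) M l r ⟩
      T * T ^ i * (M + (l + r))    ∎) , (ℚ.≤-trans (ℚ.≤-reflexive (recipSum-split M l r))
        (ℚ.≤-trans (ℚ.+-mono-≤ small (block-upper a (≤-trans T²≤M (m≤m+n M l))))
          (ℚ.≤-reflexive (trans (sym (/-+ i 1 (pred T))) (cong (λ x → + x / pred T) (+-comm i 1))))))
      where
      open ≤-Reasoning
      a = M + l
      r = suc (a ℕ./ T)
      eq₁ : ∀ t x a → (1 + t) * (x * a) ≡ x * (a + t * a)
      eq₁ = solve-∀
      eq₂ : ∀ t x m l r → x * (r * t + t * (m + l)) ≡ t * x * (m + (l + r))
      eq₂ = solve-∀

    blocks-lower : ∀ i → ∃[ l ] (T ^ i * (M + l) ≤ suc T ^ i * M × + i / (2 + T) ℚ.≤ recipSum M l)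
    blocks-lower zero    = 0 , *-monoʳ-≤ 1 (≤-reflexive (+-identityʳ M)) , /-mono 0 (2 + T) 0 1 z≤n
    blocks-lower (suc i) with blocks-lower i
    ... | l , near , big = l + r , (begin
      T * T ^ i * (M + (l + r))    ≡⟨ eq₂ T (T ^ i) M l r ⟩
      T ^ i * (r * T + T * a)      ≤⟨ *-monoʳ-≤ (T ^ i) (+-monoˡ-≤ (T * a) (m/n*n≤m a T)) ⟩
      T ^ i * (a + T * a)          ≡⟨ eq₁ T (T ^ i) a ⟩
      suc T * (T ^ i * a)          ≤⟨ *-monoʳ-≤ (suc T) near ⟩
      suc T * (suc T ^ i * M)      ≡⟨ *-assoc (suc T) (suc T ^ i) M ⟨
      suc T * suc T ^ i * M        ∎) , (ℚ.≤-trans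
        (ℚ.≤-reflexive (trans (cong (λ x → + x / (2 + T)) (+-comm 1 i)) (/-+ i 1 (2 + T))))
        (ℚ.≤-trans (ℚ.+-mono-≤ big (block-lower a (≤-trans T²≤M (m≤m+n M l))))
          (ℚ.≤-reflexive (sym (recipSum-split M l r)))))
      where
      open ≤-Reasoning
      a = M + l
      r = a ℕ./ T
      eq₁ : ∀ t x a → x * (a + t * a) ≡ (1 + t) * (x * a)
      eq₁ = solve-∀
      eq₂ : ∀ t x m l r → t * x * (m + (l + r)) ≡ x * (r * t + t * (m + l))
      eq₂ = solve-∀

  module _ (n m : ℕ) .{{n≢0 : NonZero n}} (T²≤m : T * T ≤ m) where

    M : ℕ
    M = suc m

    M+≡n*M : M + pred n * M ≡ n * M
    M+≡n*M = cong (_* M) (suc-pred n)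

    swap : ∀ x y z → x * (y * z) ≡ y * x * z
    swap = solve-∀

    -- The Riemann sum runs from M to nM, and i blocks reach at least nM when (1 + 1/T)ⁱ ≥ n.
    logSeq-upper : ∀ i → n ∕ 1 ≼ suc T ^ i ∕ T ^ i → logSeq n m ℚ.≤ + i / pred T
    logSeq-upper i (mk≼ n≤) with blocks-upper M (m≤n⇒m≤1+n T²≤m) i
    ... | l , far , small = ℚ.≤-trans (recipSum-mono M (+-cancelˡ-≤ M _ _
      (*-cancelˡ-≤ (T ^ i) {{m^n≢0 T i}} (begin
        T ^ i * (M + pred n * M)  ≡⟨ cong (T ^ i *_) M+≡n*M ⟩
        T ^ i * (n * M)           ≡⟨ swap (T ^ i) n M ⟩
        n * T ^ i * M             ≤⟨ *-monoˡ-≤ M (≤-trans n≤ (≤-reflexive (*-identityʳ (suc T ^ i)))) ⟩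
        suc T ^ i * M             ≤⟨ far ⟩
        T ^ i * (M + l)           ∎)))) small
      where open ≤-Reasoning

    logSeq-lower : ∀ i → suc T ^ i ∕ T ^ i ≼ n ∕ 1 → + i / (2 + T) ℚ.≤ logSeq n m
    logSeq-lower i (mk≼ ≤n) with blocks-lower M (m≤n⇒m≤1+n T²≤m) i
    ... | l , near , big = ℚ.≤-trans big (recipSum-mono M (+-cancelˡ-≤ M _ _
      (*-cancelˡ-≤ (T ^ i) {{m^n≢0 T i}} (begin
        T ^ i * (M + l)           ≤⟨ near ⟩
        suc T ^ i * M             ≤⟨ *-monoˡ-≤ M (≤-trans (≤-reflexive (sym (*-identityʳ (suc T ^ i)))) ≤n) ⟩
        n * T ^ i * M             ≡⟨ swap (T ^ i) n M ⟨
        T ^ i * (n * M)           ≡⟨ cong (T ^ i *_) M+≡n*M ⟨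
        T ^ i * (M + pred n * M)  ∎))))
      where open ≤-Reasoning

-- Choice of the scale Λ and conclusion

n≤2^n : ∀ n → n ≤ 2 ^ n
n≤2^n zero    = z≤n
n≤2^n (suc n) = +-mono-≤ (m^n>0 2 n) (≤-trans (n≤2^n n) (m≤m+n (2 ^ n) 0))

n²≤2^n : ∀ n → 4 ≤ n → n * n ≤ 2 ^ n
n²≤2^n n 4≤n with m≤n⇒∃[o]m+o≡n 4≤n
... | o , refl = go o
  where
  open ≤-Reasoning
  eq₁ : ∀ o → (5 + o) * (5 + o) + (7 + o * (6 + o)) ≡ 2 * ((4 + o) * (4 + o))
  eq₁ = solve-∀
  go : ∀ o → (4 + o) * (4 + o) ≤ 2 ^ (4 + o)
  go zero    = ≤-refl
  go (suc o) = begin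
    (5 + o) * (5 + o)                      ≤⟨ m≤m+n _ _ ⟩
    (5 + o) * (5 + o) + (7 + o * (6 + o))  ≡⟨ eq₁ o ⟩
    2 * ((4 + o) * (4 + o))                ≤⟨ *-monoʳ-≤ 2 (go o) ⟩
    2 * 2 ^ (4 + o)                        ∎

-- Descend from the exponent x, which suffices because x ≤ 2ˣ. Where the descent stops, the
-- preceding power is below x, so one more factor b/a ≤ C stays below xC.
least-exponent : ∀ a b C x .{{_ : NonZero x}} .{{_ : NonZero C}} → 2 ∕ 1 ≼ b ∕ a → b ∕ a ≼ C ∕ 1 →
  ∃[ ω ] (x ∕ 1 ≼ b ^ ω ∕ a ^ ω × b ^ ω ∕ a ^ ω ≼ x * C ∕ 1)
least-exponent a b C x 2≼ (mk≼ b≤) = go x (mk≼ (begin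
  x * a ^ x        ≤⟨ *-monoˡ-≤ (a ^ x) (n≤2^n x) ⟩
  2 ^ x * a ^ x    ≤⟨ cross (≼-^ 2≼ x) ⟩
  b ^ x * 1 ^ x    ≡⟨ cong (b ^ x *_) (^-zeroˡ x) ⟩
  b ^ x * 1        ∎))
  where
  open ≤-Reasoning
  eq : ∀ x y c a → x * y * (c * a) ≡ x * c * (a * y)
  eq = solve-∀
  go : ∀ w → x ∕ 1 ≼ b ^ w ∕ a ^ w → ∃[ ω ] (x ∕ 1 ≼ b ^ ω ∕ a ^ ω × b ^ ω ∕ a ^ ω ≼ x * C ∕ 1)
  go zero    h = 0 , h , mk≼ (*-monoˡ-≤ 1 (>-nonZero⁻¹ (x * C) {{m*n≢0 x C}}))
  go (suc w) h with x * a ^ w ≤? b ^ w * 1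
  ... | yes h′ = go w (mk≼ h′)
  ... | no ¬h′ = suc w , h , mk≼ (begin
    b * b ^ w * 1          ≡⟨ *-assoc b (b ^ w) 1 ⟩
    b * (b ^ w * 1)        ≤⟨ *-monoʳ-≤ b (<⇒≤ (≰⇒> ¬h′)) ⟩
    b * (x * a ^ w)        ≡⟨ *-comm b _ ⟩
    x * a ^ w * b          ≡⟨ cong (x * a ^ w *_) (*-identityʳ b) ⟨
    x * a ^ w * (b * 1)    ≤⟨ *-monoʳ-≤ (x * a ^ w) b≤ ⟩
    x * a ^ w * (C * a)    ≡⟨ eq x (a ^ w) C a ⟩
    x * C * (a * a ^ w)    ∎)

module Scale (p q C : ℕ) (2≤q : 2 ≤ q) (C≡4^q : C ≡ 4 ^ q) where
  open ≤-Reasoning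

  T : ℕ
  T = q + q

  instance
    C≢0 : NonZero C
    C≢0 = subst NonZero (sym C≡4^q) (m^n≢0 4 q)

    q≢0 : NonZero q
    q≢0 = >-nonZero (≤-trans (s≤s z≤n) 2≤q)

    T≢0 : NonZero T
    T≢0 = >-nonZero (≤-trans (>-nonZero⁻¹ q) (m≤m+n q q))

  -- The least size demanded of ω. The summands serve, in order, ω² ≤ 2^ω, then 8CΛ ≤ ω² and TΛ ≤
  -- ω², and finally p · 8C ≤ Λ.
  Q : ℕ
  Q = 4 + 8 * C * q + T * q + p * (8 * C)

  record Scaled (n ω : ℕ) : Set where
    field
      8n≼     : 8 * n ∕ 1 ≼ suc T ^ (T * (q * ω)) ∕ T ^ (T * (q * ω))
      ≼8nC    : suc T ^ (T * (q * ω)) ∕ T ^ (T * (q * ω)) ≼ 8 * n * C ∕ 1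
      8CΛ≤2^ω : 8 * C * (q * ω) ≤ 2 ^ ω
      TΛ≤n    : T * (q * ω) ≤ n
      p8C≤Λ   : p * (8 * C) ≤ q * ω
      0<ω     : 0 < ω

  4≽ : suc T ^ T ∕ T ^ T ≼ 4 ∕ 1
  4≽ = subst₂ (λ x y → x ∕ y ≼ 4 ∕ 1) (sym (^-distribˡ-+-* (suc T) q q)) (sym (^-distribˡ-+-* T q q)) (≼-* ([1+1/2q]^q≼2 q) ([1+1/2q]^q≼2 q))

  β^q≼C : suc T ^ (T * q) ∕ T ^ (T * q) ≼ C ∕ 1
  β^q≼C = subst₂ (λ x y → x ∕ y ≼ C ∕ 1) (^-*-assoc (suc T) T q) (^-*-assoc T T q)
    (subst₂ (λ x y → (suc T ^ T) ^ q ∕ (T ^ T) ^ q ≼ x ∕ y) (sym C≡4^q) (^-zeroˡ q) (≼-^ 4≽ q))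

  2^≼ : ∀ e → 2 ^ e ∕ 1 ≼ suc T ^ (T * e) ∕ T ^ (T * e)
  2^≼ e = subst₂ (λ x y → 2 ^ e ∕ 1 ≼ x ∕ y) (^-*-assoc (suc T) T e) (^-*-assoc T T e)
    (subst (λ y → 2 ^ e ∕ y ≼ (suc T ^ T) ^ e ∕ (T ^ T) ^ e) (^-zeroˡ e) (≼-^ (2≼lower T) e))

  scaled : ∀ n → C ^ Q ≤ n → ∃[ ω ] Scaled n ω
  scaled n C^Q≤n with least-exponent (T ^ (T * q)) (suc T ^ (T * q)) C (8 * n) {{8n≢0}}
      (≼-trans (2 ^ q) 1 (mk≼ (≤-trans (≤-reflexive (*-identityʳ 2)) (≤-trans (^-monoʳ-≤ 2 {1} {q} (>-nonZero⁻¹ q)) (≤-reflexive (sym (*-identityʳ _))))))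
        (2^≼ q))
      β^q≼C
    where
    8n≢0 : NonZero (8 * n)
    8n≢0 = m*n≢0 8 n {{_}} {{>-nonZero (≤-trans (m^n>0 C Q) C^Q≤n)}}
  ... | ω , h₁ , h₂ = ω , record
    { 8n≼ = 8n≼ ; ≼8nC = ≼8nC ; 8CΛ≤2^ω = 8CΛ≤2^ω ; TΛ≤n = TΛ≤n
    ; p8C≤Λ = ≤-trans (≤-trans (m≤n+m _ _) Q≤ω) (m≤n*m ω q)
    ; 0<ω = ≤-trans (s≤s z≤n) Q≤ω }
    where
    instance
      n≢0 : NonZero n
      n≢0 = >-nonZero (≤-trans (m^n>0 C Q) C^Q≤n)
    assoc : ∀ x → (x ^ (T * q)) ^ ω ≡ x ^ (T * (q * ω))
    assoc x = trans (^-*-assoc x (T * q) ω) (cong (x ^_) (*-assoc T q ω))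
    8n≼ = subst₂ (λ x y → 8 * n ∕ 1 ≼ x ∕ y) (assoc (suc T)) (assoc T) h₁
    ≼8nC = subst₂ (λ x y → x ∕ y ≼ 8 * n * C ∕ 1) (assoc (suc T)) (assoc T) h₂
    8n≤C^ω : 8 * n ≤ C ^ ω
    8n≤C^ω = begin
      8 * n                  ≡⟨ *-identityʳ _ ⟨
      8 * n * 1              ≡⟨ cong (8 * n *_) (^-zeroˡ ω) ⟨
      8 * n * 1 ^ ω          ≤⟨ cross (≼-trans _ _ {{m^n≢0 _ ω {{m^n≢0 T (T * q)}}}} h₁ (≼-^ β^q≼C ω)) ⟩
      C ^ ω * 1              ≡⟨ *-identityʳ _ ⟩
      C ^ ω                  ∎
    Q≤ω : Q ≤ ω
    -- A smaller ω would give 8n ≤ C^ω ≤ C^Q ≤ n.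
    Q≤ω = ≮⇒≥ λ ω<Q → <-irrefl refl (begin-strict
      n          <⟨ m<m*n n 8 (s≤s (s≤s z≤n)) ⟩
      n * 8      ≡⟨ *-comm n 8 ⟩
      8 * n      ≤⟨ 8n≤C^ω ⟩
      C ^ ω      ≤⟨ ^-monoʳ-≤ C (<⇒≤ ω<Q) ⟩
      C ^ Q      ≤⟨ C^Q≤n ⟩
      n          ∎)
    c*ω≤2^ω : ∀ c → c ≤ Q → c * ω ≤ 2 ^ ω
    c*ω≤2^ω c c≤Q = ≤-trans (*-monoˡ-≤ ω (≤-trans c≤Q Q≤ω))
      (n²≤2^n ω (≤-trans (≤-trans (m≤m+n 4 (8 * C * q)) (≤-trans (m≤m+n _ (T * q)) (m≤m+n _ (p * (8 * C))))) Q≤ω))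
    8CΛ≤2^ω : 8 * C * (q * ω) ≤ 2 ^ ω
    8CΛ≤2^ω = ≤-trans (≤-reflexive (sym (*-assoc (8 * C) q ω)))
      (c*ω≤2^ω (8 * C * q) (≤-trans (m≤n+m (8 * C * q) 4) (≤-trans (m≤m+n _ (T * q)) (m≤m+n _ (p * (8 * C))))))
    2^ω≤n : 2 ^ ω ≤ n
    -- 8C ≤ 2^ω and q ≥ 2 give 8C · 2^ω ≤ 2^(2ω) ≤ 2^(qω) ≤ (1 + 1/T)^(TΛ) ≤ 8nC.
    2^ω≤n = *-cancelˡ-≤ (8 * C) {{m*n≢0 8 C }} (begin
      8 * C * 2 ^ ω            ≤⟨ *-monoˡ-≤ (2 ^ ω) (≤-trans (m≤m*n (8 * C) (q * ω) {{m*n≢0 q ω {{q≢0}} {{>-nonZero (≤-trans (s≤s z≤n) Q≤ω)}}}}) 8CΛ≤2^ω) ⟩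
      2 ^ ω * 2 ^ ω            ≡⟨ ^-distribˡ-+-* 2 ω ω ⟨
      2 ^ (ω + ω)              ≡⟨ cong (λ t → 2 ^ (ω + t)) (+-identityʳ ω) ⟨
      2 ^ (2 * ω)              ≤⟨ ^-monoʳ-≤ 2 (*-monoˡ-≤ ω 2≤q) ⟩
      2 ^ (q * ω)              ≡⟨ *-identityʳ _ ⟨
      2 ^ (q * ω) * 1          ≤⟨ cross (≼-trans _ _ {{m^n≢0 T (T * (q * ω))}} (2^≼ (q * ω)) ≼8nC) ⟩
      8 * n * C * 1            ≡⟨ eq n C ⟩
      8 * C * n                ∎)
      where
      eq : ∀ n c → 8 * n * c * 1 ≡ 8 * c * n
      eq = solve-∀
    TΛ≤n : T * (q * ω) ≤ n
    TΛ≤n = ≤-trans (≤-reflexive (sym (*-assoc T q ω)))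
      (≤-trans (c*ω≤2^ω (T * q) (≤-trans (m≤n+m (T * q) (4 + 8 * C * q)) (m≤m+n _ (p * (8 * C))))) 2^ω≤n)

-- Arithmetic of the two bounds for K log n / n

-- From K ≤ 2k₂ - k₀ with k₂ ≤ n/μ and k₀ ≥ n/Λ - 1. Measured in n/((1 + p)Λ), the three
-- contributions are 2(2 + p), -(1 + p) and at most 1. The negative one is moved across to avoid
-- subtraction.
K[1+p]Λ≤[4+p]n : ∀ p n Λ μ K k₀ k₂ → μ * (2 + p) ≡ (1 + p) * Λ → K + k₀ ≤ 2 * k₂ → k₂ * μ ≤ n →
  n ≤ suc k₀ * Λ → (1 + p) * Λ ≤ n → K * ((1 + p) * Λ) ≤ (4 + p) * n
K[1+p]Λ≤[4+p]n p n Λ μ K k₀ k₂ μ≡ K+k₀≤ k₂μ≤n n≤ Λ≤n = +-cancelʳ-≤ (n * (1 + p)) _ _ (begin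
  K * ((1 + p) * Λ) + n * (1 + p)              ≤⟨ +-monoʳ-≤ (K * ((1 + p) * Λ)) (*-monoˡ-≤ (1 + p) n≤) ⟩
  K * ((1 + p) * Λ) + suc k₀ * Λ * (1 + p)     ≡⟨ eq₁ K p Λ k₀ ⟩
  (K + k₀) * ((1 + p) * Λ) + (1 + p) * Λ       ≡⟨ cong (λ t → (K + k₀) * t + (1 + p) * Λ) μ≡ ⟨
  (K + k₀) * (μ * (2 + p)) + (1 + p) * Λ       ≤⟨ +-mono-≤ (*-monoˡ-≤ (μ * (2 + p)) K+k₀≤) Λ≤n ⟩
  2 * k₂ * (μ * (2 + p)) + n                   ≡⟨ eq₂ k₂ μ p n ⟩
  k₂ * μ * (2 * (2 + p)) + n                   ≤⟨ +-monoˡ-≤ n (*-monoˡ-≤ (2 * (2 + p)) k₂μ≤n) ⟩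
  n * (2 * (2 + p)) + n                        ≡⟨ eq₃ n p ⟩
  (4 + p) * n + n * (1 + p)                    ∎)
  where
  open ≤-Reasoning
  eq₁ : ∀ K p l k → K * ((1 + p) * l) + (1 + k) * l * (1 + p) ≡ (K + k) * ((1 + p) * l) + (1 + p) * l
  eq₁ = solve-∀
  eq₂ : ∀ k m p n → 2 * k * (m * (2 + p)) + n ≡ k * m * (2 * (2 + p)) + n
  eq₂ = solve-∀
  eq₃ : ∀ n p → n * (2 * (2 + p)) + n ≡ (4 + p) * n + n * (1 + p)
  eq₃ = solve-∀

-- With T = t + 1, the loss T/(T - 1) in the upper bound for log n is at most (1 + p)/p.
K[1+t]Λp≤[p+4]nt : ∀ p n Λ K t → p ≤ t → K * ((1 + p) * Λ) ≤ (4 + p) * n → K * (suc t * Λ) * p ≤ (p + 4) * (n * t)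
K[1+t]Λp≤[p+4]nt p n Λ K t p≤t h = begin
  K * (suc t * Λ) * p          ≡⟨ eq₁ K t Λ p ⟩
  K * Λ * (p + t * p)          ≤⟨ *-monoʳ-≤ (K * Λ) (+-monoˡ-≤ (t * p) p≤t) ⟩
  K * Λ * (t + t * p)          ≡⟨ eq₂ K Λ t p ⟩
  K * ((1 + p) * Λ) * t        ≤⟨ *-monoˡ-≤ t h ⟩
  (4 + p) * n * t              ≡⟨ eq₃ p n t ⟩
  (p + 4) * (n * t)            ∎
  where
  open ≤-Reasoning
  eq₁ : ∀ K t l p → K * ((1 + t) * l) * p ≡ K * l * (p + t * p)
  eq₁ = solve-∀
  eq₂ : ∀ K l t p → K * l * (t + t * p) ≡ K * ((1 + p) * l) * t
  eq₂ = solve-∀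
  eq₃ : ∀ p n t → (4 + p) * n * t ≡ (p + 4) * (n * t)
  eq₃ = solve-∀

-- Each of the three approximations loses a factor 1 - 1/p, and f/p ≤ (1 - 1/p)³ for p = f + 4.
fn[2+T]≤KT[Λ∸s]p : ∀ f n Λ K T s .{{_ : NonZero Λ}} (let p = 4 + f) → n ≤ suc K * Λ → p * Λ ≤ n → p * s ≤ Λ →
  2 * p ≤ T → f * (n * (2 + T)) ≤ K * (T * (Λ ∸ s)) * p
fn[2+T]≤KT[Λ∸s]p f n Λ K T s n≤ pΛ≤n ps≤Λ 2p≤T = *-cancelˡ-≤ (p * p * Λ) {{m*n≢0 (p * p) Λ}} (begin
  -- The discarded coefficient 27 + 11f + f² is (p - 1)³ - f p².
  p * p * Λ * (f * (n * (2 + T)))                          ≤⟨ m≤m+n _ ((27 + 11 * f + f * f) * Λ * n * (2 + T)) ⟩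
  p * p * Λ * (f * (n * (2 + T))) + (27 + 11 * f + f * f) * Λ * n * (2 + T)
                                                           ≡⟨ eq₁ f Λ n T ⟩
  (3 + f) * n * ((3 + f) * Λ * ((3 + f) * (2 + T)))        ≤⟨ *-mono-≤ step₁ (*-mono-≤ step₂ step₃) ⟩
  p * (K * Λ) * (p * r * (p * T))                          ≡⟨ eq₂ p K Λ r T ⟩
  p * p * Λ * (K * (T * r) * p)                            ∎)
  where
  open ≤-Reasoning
  p = 4 + f
  r = Λ ∸ s
  eq₁ : ∀ f l n t → (4 + f) * (4 + f) * l * (f * (n * (2 + t))) + (27 + 11 * f + f * f) * l * n * (2 + t)
                    ≡ (3 + f) * n * ((3 + f) * l * ((3 + f) * (2 + t)))
  eq₁ = solve-∀
  eq₂ : ∀ p k l r t → p * (k * l) * (p * r * (p * t)) ≡ p * p * l * (k * (t * r) * p)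
  eq₂ = solve-∀
  eq₃ : ∀ f n → (3 + f) * n + n ≡ (4 + f) * n
  eq₃ = solve-∀
  eq₄ : ∀ p k l → p * ((1 + k) * l) ≡ p * (k * l) + p * l
  eq₄ = solve-∀
  eq₅ : ∀ f t → (3 + f) * (2 + t) + (2 + t) ≡ (4 + f) * t + 2 * (4 + f)
  eq₅ = solve-∀
  step₁ : (3 + f) * n ≤ p * (K * Λ)
  step₁ = +-cancelʳ-≤ n _ _ (begin
    (3 + f) * n + n          ≡⟨ eq₃ f n ⟩
    p * n                    ≤⟨ *-monoʳ-≤ p n≤ ⟩
    p * (suc K * Λ)          ≡⟨ eq₄ p K Λ ⟩
    p * (K * Λ) + p * Λ      ≤⟨ +-monoʳ-≤ (p * (K * Λ)) pΛ≤n ⟩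
    p * (K * Λ) + n          ∎)
  step₂ : (3 + f) * Λ ≤ p * r
  step₂ = +-cancelʳ-≤ Λ _ _ (begin
    (3 + f) * Λ + Λ          ≡⟨ eq₃ f Λ ⟩
    p * Λ                    ≤⟨ *-monoʳ-≤ p (m≤n+m∸n Λ s) ⟩
    p * (s + r)              ≡⟨ *-distribˡ-+ p s r ⟩
    p * s + p * r            ≤⟨ +-monoˡ-≤ (p * r) ps≤Λ ⟩
    Λ + p * r                ≡⟨ +-comm Λ _ ⟩
    p * r + Λ                ∎)
  step₃ : (3 + f) * (2 + T) ≤ p * T
  step₃ = +-cancelʳ-≤ (2 + T) _ _ (begin
    (3 + f) * (2 + T) + (2 + T)   ≡⟨ eq₅ f T ⟩
    p * T + 2 * p                 ≤⟨ +-monoʳ-≤ (p * T) (≤-trans 2p≤T (m≤n+m T 2)) ⟩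
    p * T + (2 + T)               ∎)

module Bounds (f q C n ω K : ℕ) .{{n≢0 : NonZero n}}
  (2≤q : 2 ≤ q) (C≡4^q : C ≡ 4 ^ q) (q≡ : q ≡ 4 * (2 + (4 + f)))
  (scaled : Scale.Scaled (4 + f) q C 2≤q C≡4^q n ω) (peak : IsPeak n K) where

  open ≤-Reasoning
  open Scale (4 + f) q C 2≤q C≡4^q using (T; C≢0; q≢0; T≢0; 2^≼)
  open Scale.Scaled scaled

  p Λ μ : ℕ
  p = 4 + f
  Λ = q * ω
  μ = 4 * (1 + p) * ω

  instance
    ω≢0 : NonZero ω
    ω≢0 = >-nonZero 0<ω
    Λ≢0 : NonZero Λ
    Λ≢0 = m*n≢0 q ω
    μ≢0 : NonZero μ
    μ≢0 = m*n≢0 (4 * (1 + p)) ω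
    predT≢0 : NonZero (pred T)
    predT≢0 = >-nonZero (pred-mono-≤ (+-mono-≤ (>-nonZero⁻¹ q) (>-nonZero⁻¹ q)))

  k₀ k₂ a : ℕ
  k₀ = n ℕ./ Λ
  k₂ = n ℕ./ μ
  a  = k₂ ∸ k₀

  μ≤Λ : μ ≤ Λ
  μ≤Λ = *-monoˡ-≤ ω (≤-trans (*-monoʳ-≤ 4 (n≤1+n (1 + p))) (≤-reflexive (sym q≡)))

  k₀+a≡k₂ : k₀ + a ≡ k₂
  k₀+a≡k₂ = m+[n∸m]≡n (/-monoʳ-≤ n μ≤Λ)

  n≤k₀Λ : n ≤ suc k₀ * Λ
  n≤k₀Λ = <⇒≤ (m<[1+m/n]*n n Λ)

  open Location n p q ω C q≡ 8n≼ ≼8nC 8CΛ≤2^ω k₀ a (m/n*n≤m n Λ) n≤k₀Λ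
    (≤-trans (≤-reflexive (sym (m*n/n≡m T Λ))) (/-mono-≤ TΛ≤n (≤-refl {Λ})))
    (subst (λ k → n ≤ suc k * μ) (sym k₀+a≡k₂) (<⇒≤ (m<[1+m/n]*n n μ)))
    using (peak-≥; peak-≤)

  4p≤q : 4 * p ≤ q
  4p≤q = ≤-trans (*-monoʳ-≤ 4 (m≤n+m p 2)) (≤-reflexive (sym q≡))

  p<T : suc p ≤ T
  p<T = +-mono-≤ (>-nonZero⁻¹ q) (≤-trans (m≤n*m p 4) 4p≤q)

  K-upper : K * (T * Λ) * p ≤ (p + 4) * (n * pred T)
  K-upper = subst (λ t → K * (t * Λ) * p ≤ (p + 4) * (n * pred T)) (suc-pred T)
    (K[1+t]Λp≤[p+4]nt p n Λ K (pred T) (pred-mono-≤ p<T)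
      (K[1+p]Λ≤[4+p]n p n Λ μ K k₀ k₂ (trans (eq₁ p ω) (cong (λ t → (1 + p) * (t * ω)) (sym q≡)))
        K+k₀≤ (m/n*n≤m n μ) n≤k₀Λ (≤-trans (*-monoˡ-≤ Λ p<T) TΛ≤n)))
    where
    eq₁ : ∀ p ω → 4 * (1 + p) * ω * (2 + p) ≡ (1 + p) * (4 * (2 + p) * ω)
    eq₁ = solve-∀
    eq₂ : ∀ k a → k + a + a + k ≡ 2 * (k + a)
    eq₂ = solve-∀
    K+k₀≤ : K + k₀ ≤ 2 * k₂
    K+k₀≤ = begin
      K + k₀              ≤⟨ +-monoˡ-≤ k₀ (peak-≤ peak) ⟩
      k₀ + a + a + k₀     ≡⟨ eq₂ k₀ a ⟩
      2 * (k₀ + a)        ≡⟨ cong (2 *_) k₀+a≡k₂ ⟩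
      2 * k₂              ∎

  K-lower : f * (n * (2 + T)) ≤ K * (T * (Λ ∸ 8 * C)) * p
  K-lower = fn[2+T]≤KT[Λ∸s]p f n Λ K T (8 * C) (≤-trans n≤k₀Λ (*-monoˡ-≤ Λ (s≤s (peak-≥ peak))))
    (≤-trans (*-monoˡ-≤ Λ (<⇒≤ p<T)) TΛ≤n) p8C≤Λ
    (≤-trans (*-monoˡ-≤ p (m≤m+n 2 2)) (≤-trans 4p≤q (m≤m+n q q)))

  n≼ : n ∕ 1 ≼ suc T ^ (T * Λ) ∕ T ^ (T * Λ)
  n≼ = ≼-trans (8 * n) 1 (mk≼ (*-monoˡ-≤ 1 (m≤n*m n 8))) 8n≼

  -- (1 + 1/T)^(TΛ) may exceed n by a factor 8C. Lowering Λ by 8C divides by at least 2^(8C) ≥ 8C,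
  -- and costs at most the fraction 1/p of Λ.
  ≼n : suc T ^ (T * (Λ ∸ 8 * C)) ∕ T ^ (T * (Λ ∸ 8 * C)) ≼ n ∕ 1
  ≼n = mk≼ (*-cancelʳ-≤ _ _ (8 * C * T ^ (T * s)) {{m*n≢0 (8 * C) _ {{m*n≢0 8 C}} {{m^n≢0 T (T * s)}}}} (begin
    U * 1 * (8 * C * T ^ (T * s))          ≡⟨ cong (_* (8 * C * T ^ (T * s))) (*-identityʳ U) ⟩
    U * (8 * C * T ^ (T * s))              ≤⟨ *-monoʳ-≤ U (≤-trans (*-monoˡ-≤ (T ^ (T * s)) (n≤2^n s)) (cross (2^≼ s))) ⟩
    U * (suc T ^ (T * s) * 1)              ≡⟨ *-assoc U _ 1 ⟨
    U * suc T ^ (T * s) * 1                ≡⟨ cong (_* 1) (exponents (suc T)) ⟩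
    suc T ^ (T * Λ) * 1                    ≤⟨ cross ≼8nC ⟩
    8 * n * C * T ^ (T * Λ)                ≡⟨ cong (8 * n * C *_) (exponents T) ⟨
    8 * n * C * (V * T ^ (T * s))          ≡⟨ eq n C V (T ^ (T * s)) ⟩
    n * V * (8 * C * T ^ (T * s))          ∎))
    where
    s = 8 * C
    U = suc T ^ (T * (Λ ∸ s))
    V = T ^ (T * (Λ ∸ s))
    s≤Λ : s ≤ Λ
    s≤Λ = ≤-trans (m≤n*m s p) p8C≤Λ
    exponents : ∀ x → x ^ (T * (Λ ∸ s)) * x ^ (T * s) ≡ x ^ (T * Λ)
    exponents x = trans (sym (^-distribˡ-+-* x (T * (Λ ∸ s)) (T * s)))
      (cong (x ^_) (trans (sym (*-distribˡ-+ T (Λ ∸ s) s)) (cong (T *_) (m∸n+n≡m s≤Λ))))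
    eq : ∀ n c v t → 8 * n * c * (v * t) ≡ n * v * (8 * c * t)
    eq = solve-∀

  module _ (m : ℕ) (T²≤m : T * T ≤ m) where

    x : ℚ
    x = (+ K / n) ℚ.* logSeq n m

    instance
      K/n-nonNeg : ℚ.NonNegative (+ K / n)
      K/n-nonNeg = ℚ.normalize-nonNeg K n
      n*predT≢0 : NonZero (n * pred T)
      n*predT≢0 = m*n≢0 n (pred T)
      n*[2+T]≢0 : NonZero (n * (2 + T))
      n*[2+T]≢0 = m*n≢0 n (2 + T)

    ratio-upper : x ℚ.≤ + (p + 4) / p
    ratio-upper = ℚ.≤-trans
      (ℚ.*-monoˡ-≤-nonNeg (+ K / n) (Blocks.logSeq-upper T n m T²≤m (T * Λ) n≼)) (ℚ.≤-trans
      (ℚ.≤-reflexive (/-* K n (T * Λ) (pred T)))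
      (/-mono (K * (T * Λ)) (n * pred T) (p + 4) p K-upper))

    ratio-lower : + f / p ℚ.≤ x
    ratio-lower = ℚ.≤-trans
      (/-mono f p (K * (T * (Λ ∸ 8 * C))) (n * (2 + T)) K-lower) (ℚ.≤-trans
      (ℚ.≤-reflexive (sym (/-* K n (T * (Λ ∸ 8 * C)) (2 + T))))
      (ℚ.*-monoˡ-≤-nonNeg (+ K / n) (Blocks.logSeq-lower T n m T²≤m (T * (Λ ∸ 8 * C)) ≼n)))

-- With p = 4 + f, the two bounds are 1 - 4/p and 1 + 4/p.
RatioBounds : ℕ → (ℕ → ℕ) → Set
RatioBounds f K = ∃[ N ] (∀ n → .{{_ : NonZero n}} → N ≤ n → ∃[ M ] (∀ m → M ≤ m →
  + f / (4 + f) ℚ.≤ (+ K n / n) ℚ.* logSeq n m × (+ K n / n) ℚ.* logSeq n m ℚ.≤ + (4 + f + 4) / (4 + f)))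

ratio-bounds′ : ∀ f q C (K : ℕ → ℕ) → (∀ n → 2 ≤ n → IsPeak n (K n)) →
  2 ≤ q → q ≡ 4 * (2 + (4 + f)) → C ≡ 4 ^ q → RatioBounds f K
ratio-bounds′ f q C K peaks 2≤q q≡ C≡ = 2 + C ^ Scale.Q (4 + f) q C 2≤q C≡ , λ n N≤n →
    let ω , scaled = Scale.scaled (4 + f) q C 2≤q C≡ n (≤-trans (m≤n+m _ 2) N≤n)
        peak = peaks n (≤-trans (m≤m+n 2 _) N≤n)
    in (q + q) * (q + q) , λ m T²≤m →
      Bounds.ratio-lower f q C n ω (K n) 2≤q C≡ q≡ scaled peak m T²≤m ,
      Bounds.ratio-upper f q C n ω (K n) 2≤q C≡ q≡ scaled peak m T²≤m

-- q and C are passed on as variables with equations, so neither 4(p + 2) nor the power 4^q unfolds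
-- in the estimates.
ratio-bounds : ∀ f (K : ℕ → ℕ) → (∀ n → 2 ≤ n → IsPeak n (K n)) → RatioBounds f K
ratio-bounds f K peaks = with-q (4 * (2 + (4 + f))) refl
  where
  with-q : ∀ q → q ≡ 4 * (2 + (4 + f)) → RatioBounds f K
  with-q q q≡ = ratio-bounds′ f q (4 ^ q) K peaks (≤-trans (≤-trans (m≤m+n 2 (4 + f)) (m≤n*m (2 + (4 + f)) 4)) (≤-reflexive (sym q≡))) q≡ refl

-- The limit

∣x-1∣≤ : ∀ x c → x ℚ.≤ 1ℚ ℚ.+ c → 1ℚ ℚ.≤ x ℚ.+ c → ℚ.∣ x ℚ.- 1ℚ ∣ ℚ.≤ c
∣x-1∣≤ x c x≤ 1≤ with ℚ.∣p∣≡p∨∣p∣≡-p (x ℚ.- 1ℚ)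
... | inj₁ eq = begin
  ℚ.∣ x ℚ.- 1ℚ ∣          ≡⟨ eq ⟩
  x ℚ.- 1ℚ                ≤⟨ ℚ.+-monoˡ-≤ (ℚ.- 1ℚ) x≤ ⟩
  1ℚ ℚ.+ c ℚ.- 1ℚ         ≡⟨ solve 1 (λ c → con 1ℚ :+ c :- con 1ℚ := c) refl c ⟩
  c                       ∎
  where
  open ℚ.≤-Reasoning
  open +-*-Solver
... | inj₂ eq = begin
  ℚ.∣ x ℚ.- 1ℚ ∣          ≡⟨ eq ⟩
  ℚ.- (x ℚ.- 1ℚ)          ≡⟨ solve 1 (λ x → :- (x :- con 1ℚ) := con 1ℚ :- x) refl x ⟩
  1ℚ ℚ.- x                ≤⟨ ℚ.+-monoˡ-≤ (ℚ.- x) 1≤ ⟩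
  x ℚ.+ c ℚ.- x           ≡⟨ solve 2 (λ x c → x :+ c :- x := c) refl x c ⟩
  c                       ∎
  where
  open ℚ.≤-Reasoning
  open +-*-Solver

p/p≡1 : ∀ p .{{_ : NonZero p}} → + p / p ≡ 1ℚ
p/p≡1 p = /-cong′ p p 1 1 (*-comm p 1)

mainTheorem3 : (K : ℕ → ℕ) → (∀ n → 2 ≤ n → IsPeak n (K n)) →
    (λ n → (+ K n / n) · log n) ⟶ fromℚ 1ℚ
mainTheorem3 K peaks (mkℚ (+ zero) d _) 0<ε with ℚ.drop-*<* 0<ε
... | ℤ.+<+ ()
mainTheorem3 K peaks (mkℚ ℤ.-[1+ _ ] d _) 0<ε with ℚ.drop-*<* 0<ε
... | ()
mainTheorem3 K peaks ε@(mkℚ (+ suc e) d _) _ =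
  let N , bounds = ratio-bounds f K peaks
  in N , λ n N≤n →
    let M , close = bounds n N≤n
    in δ , ℚ.positive⁻¹ δ {{ℚ.normalize-pos 4 p}} , M , λ m M≤m →
      let lower , upper = close m M≤m
          x = (+ K n / n) ℚ.* logSeq n m
      in ℚ.≤-trans (ℚ.+-monoˡ-≤ δ (∣x-1∣≤ x δ
           (ℚ.≤-trans upper (ℚ.≤-reflexive (trans (/-+ p 4 p) (cong (ℚ._+ δ) (p/p≡1 p)))))
           (ℚ.≤-trans (ℚ.≤-reflexive 1≡) (ℚ.+-monoˡ-≤ δ lower))))
         2δ≤ε
  where
  f p : ℕ
  -- This makes p = 8(d + 1) and δ half of 1/(d + 1), which is at most ε/2. One δ bounds the
  -- distance to 1; the other is the positive gap demanded by `<` on reals.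
  f = 4 + 8 * d
  p = 4 + f
  δ : ℚ
  δ = + 4 / p
  1≡ : 1ℚ ≡ + f / p ℚ.+ δ
  1≡ = trans (sym (p/p≡1 p)) (trans (cong (λ t → + t / p) (+-comm 4 f)) (/-+ f 4 p))
  2δ≤ε : δ ℚ.+ δ ℚ.≤ ε
  2δ≤ε = ℚ.≤-trans (ℚ.≤-reflexive (sym (/-+ 4 4 p))) (ℚ.≤-trans
    (/-mono 8 p (suc e) (suc d) (≤-trans (≤-reflexive (eq d)) (m≤n*m p (suc e))))
    (ℚ.≤-reflexive (ℚ.↥p/↧p≡p ε)))
    where
    eq : ∀ d → 8 * (1 + d) ≡ 4 + (4 + 8 * d)
    eq = solve-∀
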